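{- For every integer $k\ge 1$, $\left(\tfrac{1}{2}(k-1)+o(1)\right)n \le \mathrm{bal}_3(n,P_{3k}) \le (k+o(1))n$ as $n\to\infty$.
   Context: $P_m$ denotes the path with $m$ edges. A $3$-edge-colored graph $G$ is balanced if each of the $3$ colors appears on either $\lfloor e(G)/3\rfloor$ or $\lceil e(G)/3\rceil$ edges (so a balanced $P_{3k}$ has exactly $k$ edges of each color). $\mathrm{bal}_3(n,G)$ is the minimum integer $m$ (if it exists) such that every $3$-edge-coloring of $K_n$ with more than $m$ edges in each of the $3$ colors contains a balanced copy of $G$; if no such $m$ exists it is $\infty$. -}

module Defs where

open import Data.Nat using (ℕ; suc; _+_; _*_; _<_; _≤_)
import Data.Nat as ℕ
open import Data.Fin using (Fin; toℕ; inject₁) renaming (suc to fsuc)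
import Data.Fin as Fin
open import Data.List using (List; length; filter; allFin; concatMap; map)
open import Data.Product using (_×_; _,_; proj₁; proj₂; Σ)
open import Relation.Nullary.Decidable using (_×-dec_)
open import Relation.Binary.PropositionalEquality using (_≡_)
open import Function.Definitions using (Injective)

-- A 3-edge-colouring of the complete graph K_n on vertex set Fin n:
-- a symmetric map c : Fin n → Fin n → Fin 3 (diagonal values are ignored).
Colouring : ℕ → Set
Colouring n = Fin n → Fin n → Fin 3

SymmetricColouring : (n : ℕ) → Colouring n → Set
SymmetricColouring n c = ∀ i j → c i j ≡ c j i

allPairs : (n : ℕ) → List (Fin n × Fin n)
allPairs n = concatMap (λ i → map (λ j → (i , j)) (allFin n)) (allFin n)

colourCount : (n : ℕ) → Colouring n → Fin 3 → ℕ
colourCount n c col =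
  length (filter (λ p → (toℕ (proj₁ p) ℕ.<? toℕ (proj₂ p))
                        ×-dec (c (proj₁ p) (proj₂ p) Fin.≟ col))
                 (allPairs n))

pathColourCount : (n m : ℕ) → Colouring n → (Fin (suc m) → Fin n) → Fin 3 → ℕ
pathColourCount n m c v col =
  length (filter (λ i → c (v (inject₁ i)) (v (fsuc i)) Fin.≟ col) (allFin m))

HasBalancedP3k : (n k : ℕ) → Colouring n → Set
HasBalancedP3k n k c =
  Σ (Fin (suc (3 * k)) → Fin n) λ v →
    Injective _≡_ _≡_ v × (∀ col → pathColourCount n (3 * k) c v col ≡ k)

-- m is admissible: every 3-edge-colouring of K_n with more than m edges of
-- each colour contains a balanced P_{3k}.  bal₃(n, P_{3k}) is the least such m.
Admissible : (n k m : ℕ) → Set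
Admissible n k m =
  (c : Colouring n) → SymmetricColouring n c →
  (∀ col → m < colourCount n c col) → HasBalancedP3k n k c

{-# OPTIONS --safe #-}
-- Lower bound: give k - 1 hub vertices, split the edges at them evenly into colours 0 and 1, and
-- colour the rest 2.  A path has at most 2(k - 1) edges at hubs, but a balanced one needs 2k.
--
-- Upper bound: Ramsey's theorem gives a large clique K of one colour d; let a, b be the other two
-- colours.  If many vertices have several a-neighbours in K, the pigeonhole principle yields
-- an a-coloured biclique with one side in K, and a-coloured zigzags of any length leaving K.  If
-- this happens for both a and b, join two zigzags through K.  If it happens only for b, all
-- but boundedly many vertices reach K by edges of colour b or d, so an a-coloured path with k edges can be
-- continued through K into a b-zigzag.  If it happens for neither, all but boundedly many vertices
-- reach K by edges of colour d, and it suffices to find disjoint monochromatic paths with k edges in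
-- colours a and b that start outside the exceptional set.  For these one combines
-- Erdős–Gallai with bicliques at the vertices of linear degree: the first path uses
-- about k/2 such vertices, so more than (k - 1)n/2 edges of the other colour survive its removal.
-- Throughout, the k of the statement is suc k.
module Submission where

open import Defs
open import Data.Bool using (if_then_else_; true; false)
open import Data.Empty using (⊥)
open import Data.Fin using (Fin; zero; suc; toℕ; fromℕ<; inject₁)
import Data.Fin as Fin
open import Data.Fin.Properties using (toℕ-injective; inject₁-injective; toℕ-fromℕ<)
import Data.Fin.Properties as FinP
open import Data.List using (List; []; _∷_; [_]; _++_; length; filter; map; take; reverse; replicate; allFin; upTo; lookup; tabulate; concatMap)
open import Data.List.Membership.Propositional using (_∈_; _∉_; lose; find)
open import Data.List.Membership.Propositional.Properties using (∈-filter⁺; ∈-filter⁻; ∈-++⁺ˡ; ∈-++⁺ʳ; ∈-++⁻; ∈-∃++; ∈-length; ∈-lookup; ∈-allFin; ∈-map⁺; ∈-map⁻; ∈-upTo⁺; ∈-upTo⁻)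
open import Data.List.Properties using (map-tabulate; length-tabulate; length-map; length-take; length-++; length-reverse; length-upTo; unfold-reverse)
open import Data.List.Relation.Binary.Permutation.Propositional using (_↭_; ↭-sym; ↭-trans; ↭-refl; ↭⇒↭ₛ)
open import Data.List.Relation.Binary.Permutation.Propositional.Properties using (↭-length; ∈-resp-↭; ++-comm; ++⁺ˡ; ↭-reverse)
import Data.List.Relation.Binary.Permutation.Setoid.Properties as PermS
open import Data.List.Relation.Unary.All using (All; []; _∷_)
import Data.List.Relation.Unary.All as All
import Data.List.Relation.Unary.All.Properties as AllP
open import Data.List.Relation.Unary.AllPairs using (AllPairs; []; _∷_)
import Data.List.Relation.Unary.AllPairs as AllPairs
import Data.List.Relation.Unary.AllPairs.Properties as AllPairsP
open import Data.List.Relation.Unary.Any using (here; there)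
import Data.List.Relation.Unary.Any as Any
open import Data.List.Relation.Unary.Unique.Propositional using (Unique)
import Data.List.Relation.Unary.Unique.Propositional.Properties as UniqueP
open import Data.Nat using (ℕ; zero; suc; _+_; _*_; _∸_; _^_; _⊓_; _⊔_; _<_; _≤_; z≤n; s≤s; s≤s⁻¹; _≤?_; _<?_; ⌊_/2⌋)
open import Data.Nat.DivMod using (_/_; _%_; m/n*n≤m; m*n/n≡m; /-monoˡ-≤; m≡m%n+[m/n]*n; m%n<n)
open import Data.Nat.Properties
open import Data.Nat.Tactic.RingSolver using (solve-∀)
open import Data.Product using (_×_; Σ; ∃; _,_; proj₁; proj₂)
open import Data.Sum using (_⊎_; inj₁; inj₂)
open import Function using (_∘_; id; case_of_)
open import Function.Definitions using (Injective)
open import Level using (0ℓ)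
open import Relation.Binary using (Rel; DecidableEquality)
import Relation.Binary as B
open import Relation.Binary.PropositionalEquality using (_≡_; _≢_; refl; sym; trans; cong; cong₂; subst; subst₂; setoid)
open import Relation.Nullary using (¬_; Dec; yes; no; does; contradiction)
open import Relation.Nullary.Decidable using (_×-dec_; ¬?)
open import Relation.Unary using (Pred; Decidable)

-- The error term is n / (t + 1) for an arbitrary parameter `t`. The size of the clique and the
-- numbers of hubs and of exceptional vertices are bounded in terms of `k` and `t` alone, hence
-- negligible for large `n`. The obstacle is the pair of disjoint paths. All k + 2 vertices of a
-- path from Erdős-Gallai could have degree close to `n` in the other colour, and deleting it could
-- then cost that colour 2(k + 2)n of its degree sum. That is twice the budget: the degree sum
-- exceeds 2(k + 1)n, and Erdős-Gallai needs kn for a path with k + 1 edges, which leaves (k + 2)n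
-- to spend. So at most about k/2 + 1 vertices of the first path may have linear degree, as in a
-- zigzag of a biclique, where only every other vertex does. This budget fixes the constant of the
-- upper bound. For the same reason exceptional vertices of linear degree cannot simply be deleted
-- before the second path is chosen; a path that starts at one of them is shifted by one edge
-- instead.

ind : {P : Set} → Dec P → ℕ
ind d = if does d then 1 else 0

ind≤1 : {P : Set} (d : Dec P) → ind d ≤ 1
ind≤1 (yes _) = s≤s z≤n
ind≤1 (no _)  = z≤n

ind-yes : {P : Set} (d : Dec P) → P → ind d ≡ 1
ind-yes (yes _) p = refl
ind-yes (no ¬p) p = contradiction p ¬p

ind-no : {P : Set} (d : Dec P) → ¬ P → ind d ≡ 0
ind-no (yes p) ¬p = contradiction p ¬p
ind-no (no _)  _  = refl

ind-mono : {P Q : Set} (d : Dec P) (e : Dec Q) → (P → Q) → ind d ≤ ind e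
ind-mono (no _)  e f = z≤n
ind-mono (yes p) e f = ≤-reflexive (sym (ind-yes e (f p)))

-- Finite sums and counting over lists

private variable
  A B : Set

∑ : (A → ℕ) → List A → ℕ
∑ f []       = 0
∑ f (x ∷ xs) = f x + ∑ f xs

count : {P : Pred A 0ℓ} → Decidable P → List A → ℕ
count P? = ∑ (λ x → ind (P? x))

length-filter≡count : {P : Pred A 0ℓ} (P? : Decidable P) (xs : List A) → length (filter P? xs) ≡ count P? xs
length-filter≡count P? [] = refl
length-filter≡count P? (x ∷ xs) with does (P? x)
... | true  = cong suc (length-filter≡count P? xs)
... | false = length-filter≡count P? xs

∑-+ : (f g : A → ℕ) (xs : List A) → ∑ (λ x → f x + g x) xs ≡ ∑ f xs + ∑ g xs
∑-+ f g [] = refl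
∑-+ f g (x ∷ xs) = trans (cong (f x + g x +_) (∑-+ f g xs)) (interchange (f x) (g x) _ _)
  where
  interchange : ∀ a b c d → a + b + (c + d) ≡ a + c + (b + d)
  interchange = solve-∀

∑-mono : {f g : A → ℕ} (xs : List A) → (∀ {x} → x ∈ xs → f x ≤ g x) → ∑ f xs ≤ ∑ g xs
∑-mono [] h = z≤n
∑-mono (x ∷ xs) h = +-mono-≤ (h (here refl)) (∑-mono xs (h ∘ there))

∑-cong : {f g : A → ℕ} (xs : List A) → (∀ {x} → x ∈ xs → f x ≡ g x) → ∑ f xs ≡ ∑ g xs
∑-cong [] h = refl
∑-cong (x ∷ xs) h = cong₂ _+_ (h (here refl)) (∑-cong xs (h ∘ there))

∑-const : (c : ℕ) (xs : List A) → ∑ (λ _ → c) xs ≡ length xs * c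
∑-const c [] = refl
∑-const c (x ∷ xs) = cong (c +_) (∑-const c xs)

∑-bound : {f : A → ℕ} (c : ℕ) (xs : List A) → (∀ {x} → x ∈ xs → f x ≤ c) → ∑ f xs ≤ length xs * c
∑-bound c xs h = ≤-trans (∑-mono xs h) (≤-reflexive (∑-const c xs))

∑-lower : {f : A → ℕ} (c : ℕ) (xs : List A) → (∀ {x} → x ∈ xs → c ≤ f x) → length xs * c ≤ ∑ f xs
∑-lower c xs h = ≤-trans (≤-reflexive (sym (∑-const c xs))) (∑-mono xs h)

∑-++ : (f : A → ℕ) (xs ys : List A) → ∑ f (xs ++ ys) ≡ ∑ f xs + ∑ f ys
∑-++ f [] ys = refl
∑-++ f (x ∷ xs) ys = trans (cong (f x +_) (∑-++ f xs ys)) (sym (+-assoc (f x) _ _))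

∑-swap : (f : A → B → ℕ) (xs : List A) (ys : List B) →
         ∑ (λ x → ∑ (f x) ys) xs ≡ ∑ (λ y → ∑ (λ x → f x y) xs) ys
∑-swap f [] ys = sym (trans (∑-const 0 ys) (*-zeroʳ (length ys)))
∑-swap f (x ∷ xs) ys = trans (cong (∑ (f x) ys +_) (∑-swap f xs ys)) (sym (∑-+ (f x) _ ys))

∑-partition : {P : Pred A 0ℓ} (P? : Decidable P) (f : A → ℕ) (xs : List A) →
              ∑ f xs ≡ ∑ f (filter (λ x → ¬? (P? x)) xs) + ∑ f (filter P? xs)
∑-partition P? f [] = refl
∑-partition P? f (x ∷ xs) with P? x
... | yes _ = trans (cong (f x +_) (∑-partition P? f xs)) (exch (f x) (∑ f (filter (λ y → ¬? (P? y)) xs)) (∑ f (filter P? xs)))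
  where
  exch : ∀ a b c → a + (b + c) ≡ b + (a + c)
  exch = solve-∀
... | no _  = trans (cong (f x +_) (∑-partition P? f xs)) (sym (+-assoc (f x) _ _))

length≡∑ : (xs : List A) → length xs ≡ ∑ (λ _ → 1) xs
length≡∑ xs = sym (trans (∑-const 1 xs) (*-identityʳ _))

length-partition : {P : Pred A 0ℓ} (P? : Decidable P) (xs : List A) →
                   length xs ≡ length (filter (λ x → ¬? (P? x)) xs) + length (filter P? xs)
length-partition P? xs = trans (length≡∑ xs) (trans (∑-partition P? _ xs)
  (sym (cong₂ _+_ (length≡∑ (filter (λ x → ¬? (P? x)) xs)) (length≡∑ (filter P? xs)))))

∑-filter≤ : {P : Pred A 0ℓ} (P? : Decidable P) (f : A → ℕ) (xs : List A) → ∑ f (filter P? xs) ≤ ∑ f xs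
∑-filter≤ P? f xs = ≤-trans (m≤n+m _ _) (≤-reflexive (sym (∑-partition P? f xs)))

-- Membership is asked only where `f` is nonzero, so that a degree into a large set can be compared
-- with the degree into a smaller set containing just the neighbours.
Unique⇒∑≤ : {f : A → ℕ} {xs : List A} (ys : List A) → Unique xs →
            (∀ {x} → x ∈ xs → f x ≢ 0 → x ∈ ys) → ∑ f xs ≤ ∑ f ys
Unique⇒∑≤ {xs = []} ys _ _ = z≤n
Unique⇒∑≤ {f = f} {xs = x ∷ xs} ys (x∉ ∷ u) h with f x in eq
... | zero  = Unique⇒∑≤ ys u (h ∘ there)
... | suc m with ys₁ , ys₂ , refl ← ∈-∃++ (h (here refl) (λ fx≡0 → case trans (sym eq) fx≡0 of λ ())) =
  ≤-trans (+-monoʳ-≤ (suc m) (Unique⇒∑≤ (ys₁ ++ ys₂) u h′)) (≤-reflexive total)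
  where
  h′ : ∀ {y} → y ∈ xs → f y ≢ 0 → y ∈ ys₁ ++ ys₂
  h′ y∈ fy≢0 with ∈-++⁻ ys₁ (h (there y∈) fy≢0)
  ... | inj₁ p         = ∈-++⁺ˡ p
  ... | inj₂ (here refl) = contradiction refl (All.lookup x∉ y∈)
  ... | inj₂ (there p) = ∈-++⁺ʳ ys₁ p
  exch : ∀ a b c → a + (b + c) ≡ b + (a + c)
  exch = solve-∀
  total : suc m + ∑ f (ys₁ ++ ys₂) ≡ ∑ f (ys₁ ++ x ∷ ys₂)
  total = trans (cong₂ _+_ (sym eq) (∑-++ f ys₁ ys₂))
         (trans (exch (f x) (∑ f ys₁) (∑ f ys₂)) (sym (∑-++ f ys₁ (x ∷ ys₂))))

Unique⇒length≤ : {xs : List A} (ys : List A) → Unique xs → (∀ {x} → x ∈ xs → x ∈ ys) → length xs ≤ length ys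
Unique⇒length≤ {xs = xs} ys u h = subst₂ _≤_ (sym (length≡∑ xs)) (sym (length≡∑ ys))
  (Unique⇒∑≤ ys u (λ x∈ _ → h x∈))

Unique-resp-↭ : {xs ys : List A} → xs ↭ ys → Unique xs → Unique ys
Unique-resp-↭ {A} p = PermS.Unique-resp-↭ (setoid A) (↭⇒↭ₛ p)

length-take≡ : (m : ℕ) (xs : List A) → m ≤ length xs → length (take m xs) ≡ m
length-take≡ m xs m≤ = trans (length-take m xs) (m≤n⇒m⊓n≡m m≤)

∈-take : (m : ℕ) {xs : List A} {x : A} → x ∈ take m xs → x ∈ xs
∈-take m {xs} p = All.lookup (AllP.take⁺ m (All.tabulate id)) p

nonempty⇒∃∈ : (xs : List A) → 0 < length xs → ∃ (_∈ xs)
nonempty⇒∃∈ (x ∷ xs) _ = x , here refl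

module Deletion {A : Set} (_≟_ : DecidableEquality A) where

  open import Data.List.Membership.DecPropositional _≟_ using (_∈?_) public

  infixl 6 _∖_
  _∖_ : List A → List A → List A
  xs ∖ ys = filter (λ x → ¬? (x ∈? ys)) xs

  ∖-∈ : ∀ {x} xs ys → x ∈ xs ∖ ys → x ∈ xs × x ∉ ys
  ∖-∈ xs ys = ∈-filter⁻ (λ x → ¬? (x ∈? ys)) {xs = xs}

  ∖-Unique : ∀ {xs} ys → Unique xs → Unique (xs ∖ ys)
  ∖-Unique ys = UniqueP.filter⁺ (λ x → ¬? (x ∈? ys))

  length-∖ : ∀ {xs} ys → Unique xs → length xs ≤ length (xs ∖ ys) + length ys
  length-∖ {xs} ys u = ≤-trans (≤-reflexive (length-partition (_∈? ys) xs))
    (+-monoʳ-≤ (length (xs ∖ ys))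
      (Unique⇒length≤ ys (UniqueP.filter⁺ (_∈? ys) u) (proj₂ ∘ ∈-filter⁻ (_∈? ys) {xs = xs})))

-- Bicliques and monochromatic cliques

record Biclique (R : A → B → Set) (H : List A) (X : List B) (s r : ℕ) : Set where
  constructor biclique
  field
    left         : List A
    right        : List B
    left-unique  : Unique left
    right-unique : Unique right
    left⊆        : ∀ {h} → h ∈ left → h ∈ H
    right⊆       : ∀ {x} → x ∈ right → x ∈ X
    left-length  : length left ≡ s
    right-length : length right ≡ r
    complete     : ∀ {h x} → h ∈ left → x ∈ right → R h x

module _ {R : A → B → Set} (R? : ∀ h x → Dec (R h x)) where

  -- Each `h` splits `X` into related and unrelated elements, and one of the two parts has at least
  -- half the required size. This costs a factor 2 for each element of `H`, after which every `h`
  -- treats all of `Y` alike.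
  uniformise : (H : List A) (X : List B) (r : ℕ) → 2 ^ length H * r ≤ length X →
    Σ (List B) λ Y → (∀ {x} → x ∈ Y → x ∈ X) × (Unique X → Unique Y) × r ≤ length Y ×
      (∀ {h} → h ∈ H → (∀ {x} → x ∈ Y → R h x) ⊎ (∀ {x} → x ∈ Y → ¬ R h x))
  uniformise [] X r le = X , id , id , subst (_≤ length X) (*-identityˡ r) le , λ ()
  uniformise (h ∷ H) X r le with 2 ^ length H * r ≤? length (filter (R? h) X)
  ... | yes le′ with uniformise H (filter (R? h) X) r le′
  ...   | Y , Y⊆ , Y-unique , r≤ , uni =
    Y , proj₁ ∘ ∈-filter⁻ (R? h) {xs = X} ∘ Y⊆ , Y-unique ∘ UniqueP.filter⁺ (R? h) , r≤ ,
    λ { (here refl) → inj₁ (proj₂ ∘ ∈-filter⁻ (R? h) {xs = X} ∘ Y⊆) ; (there h∈) → uni h∈ }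
  uniformise (h ∷ H) X r le | no ≰
    with uniformise H (filter (λ x → ¬? (R? h x)) X) r (+-cancelʳ-≤ (2 ^ length H * r) _ _ enough)
    where
    twice : ∀ p r → p * r + p * r ≡ (p + (p + 0)) * r
    twice = solve-∀
    open ≤-Reasoning
    enough : 2 ^ length H * r + 2 ^ length H * r ≤ length (filter (λ x → ¬? (R? h x)) X) + 2 ^ length H * r
    enough = begin
      2 ^ length H * r + 2 ^ length H * r ≡⟨ twice (2 ^ length H) r ⟩
      2 ^ suc (length H) * r              ≤⟨ le ⟩
      length X                            ≡⟨ length-partition (R? h) X ⟩
      length (filter (λ x → ¬? (R? h x)) X) + length (filter (R? h) X) ≤⟨ +-monoʳ-≤ _ (<⇒≤ (≰⇒> ≰)) ⟩
      length (filter (λ x → ¬? (R? h x)) X) + 2 ^ length H * r ∎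
  ... | Y , Y⊆ , Y-unique , r≤ , uni =
    Y , proj₁ ∘ ∈-filter⁻ (λ x → ¬? (R? h x)) {xs = X} ∘ Y⊆ , Y-unique ∘ UniqueP.filter⁺ (λ x → ¬? (R? h x)) , r≤ ,
    λ { (here refl) → inj₂ (proj₂ ∘ ∈-filter⁻ (λ x → ¬? (R? h x)) {xs = X} ∘ Y⊆) ; (there h∈) → uni h∈ }

  -- After uniformising, all elements of `Y` have the same neighbours in `H`, so the neighbours of a
  -- single one serve as the left side; `0 < r` provides that one.
  biclique-of-degrees : {H : List A} {X : List B} (s r : ℕ) → Unique H → Unique X →
    (∀ {x} → x ∈ X → s ≤ count (λ h → R? h x) H) → 0 < r → 2 ^ length H * r ≤ length X →
    Biclique R H X s r
  biclique-of-degrees {H} {X} s r uH uX deg 0<r le with uniformise H X r le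
  ... | Y , Y⊆ , Y-unique , r≤ , uni = record
    { left = take s N ; right = take r Y
    ; left-unique = UniqueP.take⁺ s (UniqueP.filter⁺ (λ h → R? h x₀) uH)
    ; right-unique = UniqueP.take⁺ r (Y-unique uX)
    ; left⊆ = proj₁ ∘ N-∈ ∘ ∈-take s ; right⊆ = Y⊆ ∘ ∈-take r
    ; left-length = length-take≡ s N (≤-trans (deg (Y⊆ x₀∈)) (≤-reflexive (sym (length-filter≡count (λ h → R? h x₀) H))))
    ; right-length = length-take≡ r Y r≤
    ; complete = λ h∈ x∈ → complete (N-∈ (∈-take s h∈)) (∈-take r x∈) }
    where
    x₀ = proj₁ (nonempty⇒∃∈ Y (≤-trans 0<r r≤))
    x₀∈ = proj₂ (nonempty⇒∃∈ Y (≤-trans 0<r r≤))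
    N = filter (λ h → R? h x₀) H
    N-∈ : ∀ {h} → h ∈ N → h ∈ H × R h x₀
    N-∈ = ∈-filter⁻ (λ h → R? h x₀) {xs = H}
    complete : ∀ {h x} → h ∈ H × R h x₀ → x ∈ Y → R h x
    complete (h∈ , Rhx₀) x∈ with uni h∈
    ... | inj₁ all  = all x∈
    ... | inj₂ none = contradiction Rhx₀ (none x₀∈)

  -- Averaging: if too few elements of `X` had more than `s` neighbours in `H`, these would
  -- contribute at most `c * (2 ^ c * r)` to the sum, and all others at most `s` each.
  biclique-of-sum : {H : List A} {X : List B} (c s r : ℕ) → Unique H → Unique X → length H ≤ c → 0 < r →
    s * length X + c * (2 ^ c * r) < ∑ (λ x → count (λ h → R? h x) H) X → Biclique R H X (suc s) r
  biclique-of-sum {H} {X} c s r uH uX H≤c 0<r lt with 2 ^ length H * r ≤? length rich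
    where rich = filter (λ x → s <? count (λ h → R? h x) H) X
  ... | yes le = restrict (biclique-of-degrees (suc s) r uH
                   (UniqueP.filter⁺ (λ x → s <? count (λ h → R? h x) H) uX)
                   (proj₂ ∘ ∈-filter⁻ (λ x → s <? count (λ h → R? h x) H) {xs = X}) 0<r le)
    where
    restrict : Biclique R H (filter (λ x → s <? count (λ h → R? h x) H) X) (suc s) r → Biclique R H X (suc s) r
    restrict (biclique l r ul ur l⊆ r⊆ ll rl com) =
      biclique l r ul ur l⊆ (proj₁ ∘ ∈-filter⁻ (λ x → s <? count (λ h → R? h x) H) {xs = X} ∘ r⊆) ll rl com
  ... | no ≰ = contradiction lt (≤⇒≯ (begin
      ∑ dg X                                    ≡⟨ ∑-partition rich? dg X ⟩
      ∑ dg (filter (λ x → ¬? (rich? x)) X) + ∑ dg (filter rich? X)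
        ≤⟨ +-mono-≤ (∑-bound s (filter (λ x → ¬? (rich? x)) X) λ x∈ → ≮⇒≥ (proj₂ (∈-filter⁻ (λ x → ¬? (rich? x)) {xs = X} x∈)))
                    (∑-bound (length H) (filter rich? X) λ {x} _ → dg≤ x) ⟩
      length (filter (λ x → ¬? (rich? x)) X) * s + length (filter rich? X) * length H
        ≤⟨ +-mono-≤ (*-monoˡ-≤ s poor≤) (*-mono-≤ rich≤ H≤c) ⟩
      length X * s + 2 ^ c * r * c             ≡⟨ cong₂ _+_ (*-comm (length X) s) (*-comm (2 ^ c * r) c) ⟩
      s * length X + c * (2 ^ c * r)            ∎))
    where
    open ≤-Reasoning
    dg : B → ℕ
    dg x = count (λ h → R? h x) H
    rich? : Decidable (λ x → s < dg x)
    rich? x = s <? dg x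
    dg≤ : ∀ x → dg x ≤ length H
    dg≤ x = ≤-trans (∑-bound 1 H λ {h} _ → ind≤1 (R? h x)) (≤-reflexive (*-identityʳ _))
    poor≤ : length (filter (λ x → ¬? (rich? x)) X) ≤ length X
    poor≤ = ≤-trans (m≤m+n _ _) (≤-reflexive (sym (length-partition rich? X)))
    rich≤ : length (filter rich? X) ≤ 2 ^ c * r
    rich≤ = ≤-trans (<⇒≤ (≰⇒> ≰)) (*-monoˡ-≤ r (^-monoʳ-≤ 2 H≤c))

classes₃ : (f : A → Fin 3) (xs : List A) → length xs ≡ length (filter (λ x → f x Fin.≟ zero) xs)
  + length (filter (λ x → f x Fin.≟ suc zero) xs) + length (filter (λ x → f x Fin.≟ suc (suc zero)) xs)
classes₃ f [] = refl
classes₃ f (x ∷ xs) with f x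
... | zero           = cong suc (classes₃ f xs)
... | suc zero       = trans (cong suc (classes₃ f xs)) (cong (_+ length (filter (λ y → f y Fin.≟ suc (suc zero)) xs))
      (sym (+-suc (length (filter (λ y → f y Fin.≟ zero) xs)) (length (filter (λ y → f y Fin.≟ suc zero) xs)))))
... | suc (suc zero) = trans (cong suc (classes₃ f xs)) (sym (+-suc _ _))

pigeonhole₃ : (f : A → Fin 3) (xs : List A) (m : ℕ) → 3 * m ≤ length xs →
  Σ (Fin 3) λ a → m ≤ length (filter (λ x → f x Fin.≟ a) xs)
pigeonhole₃ f xs m le with m ≤? size zero | m ≤? size (suc zero) | m ≤? size (suc (suc zero))
  where
  size : Fin 3 → ℕ
  size a = length (filter (λ x → f x Fin.≟ a) xs)
... | yes p | _ | _ = zero , p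
... | no _ | yes p | _ = suc zero , p
... | no _ | no _ | yes p = suc (suc zero) , p
... | no p | no q | no r = contradiction le (<⇒≱ (begin-strict
    length xs   ≡⟨ classes₃ f xs ⟩
    _           <⟨ +-mono-< (+-mono-< (≰⇒> p) (≰⇒> q)) (≰⇒> r) ⟩
    m + m + m   ≡⟨ thrice m ⟩
    3 * m       ∎))
  where
  open ≤-Reasoning
  thrice : ∀ m → m + m + m ≡ 3 * m
  thrice = solve-∀

module Ramsey (c : A → A → Fin 3) where

  Clique : Fin 3 → List A → Set
  Clique a = AllPairs (λ x y → x ≢ y × c x y ≡ a)

  private
    Coherent : List (A × Fin 3) → Set
    Coherent = AllPairs (λ (x , a) (y , _) → x ≢ y × c x y ≡ a)

    -- Each vertex is labelled with the common colour of its edges to all later ones: keep a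
    -- frequent colour class at the head and repeat. Dropping the head and keeping a third of the
    -- rest is affordable because `3 * 4 ^ s + 1 ≤ 4 ^ suc s`. Vertices with equal labels then span
    -- a monochromatic clique.
    coherent : ∀ s (X : List A) → Unique X → 4 ^ s ≤ length X →
      Σ (List (A × Fin 3)) λ ys → length ys ≡ s × (∀ {p} → p ∈ ys → proj₁ p ∈ X) × Coherent ys
    coherent zero X _ _ = [] , refl , (λ ()) , []
    coherent (suc s) [] _ le = contradiction (≤-trans (m^n>0 4 (suc s)) le) λ ()
    coherent (suc s) (x ∷ X) (x∉ ∷ uX) le
      with a , big ← pigeonhole₃ (c x) X (4 ^ s) (s≤s⁻¹ (≤-trans (+-monoˡ-≤ (3 * 4 ^ s) (m^n>0 4 s)) le))
      with ys , ly , ys⊆ , coh ← coherent s (filter (λ y → c x y Fin.≟ a) X) (UniqueP.filter⁺ (λ y → c x y Fin.≟ a) uX) big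
      = (x , a) ∷ ys , cong suc ly
      , (λ { (here refl) → here refl ; (there p∈) → there (proj₁ (sel p∈ ys⊆)) })
      , All.tabulate (λ p∈ → All.lookup x∉ (proj₁ (sel p∈ ys⊆)) , proj₂ (sel p∈ ys⊆)) ∷ coh
      where
      sel : ∀ {p : A × Fin 3} {ys} → p ∈ ys → (∀ {p} → p ∈ ys → proj₁ p ∈ filter (λ y → c x y Fin.≟ a) X) →
            proj₁ p ∈ X × c x (proj₁ p) ≡ a
      sel p∈ h = ∈-filter⁻ (λ y → c x y Fin.≟ a) {xs = X} (h p∈)

    clique-of : ∀ a ys → Coherent ys → Clique a (map proj₁ (filter (λ p → proj₂ p Fin.≟ a) ys))
    clique-of a [] _ = []
    clique-of a ((x , b) ∷ ys) (h ∷ coh) with b Fin.≟ a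
    ... | yes refl = AllP.map⁺ (AllP.filter⁺ (λ p → proj₂ p Fin.≟ a) h) ∷ clique-of a ys coh
    ... | no _     = clique-of a ys coh

  ramsey : ∀ M (X : List A) → Unique X → 4 ^ (3 * M) ≤ length X →
    Σ (Fin 3) λ a → Σ (List A) λ K → length K ≡ M × Clique a K
  ramsey M X uX le with ys , ly , _ , coh ← coherent (3 * M) X uX le
    with a , big ← pigeonhole₃ proj₂ ys M (≤-reflexive (sym ly)) =
    a , take M K , length-take≡ M K (subst (M ≤_) (sym (length-map proj₁ (filter (λ p → proj₂ p Fin.≟ a) ys))) big)
    , AllPairsP.take⁺ M (clique-of a ys coh)
    where
    K = map proj₁ (filter (λ p → proj₂ p Fin.≟ a) ys)
-- Paths in dense graphs

data Walk {A : Set} (_~_ : Rel A 0ℓ) : A → A → List A → Set where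
  stop : ∀ {x} → Walk _~_ x x [ x ]
  step : ∀ {x y z xs} → x ~ y → Walk _~_ y z xs → Walk _~_ x z (x ∷ xs)

module Graph {A : Set} (_≟_ : DecidableEquality A) (_~_ : Rel A 0ℓ) (_~?_ : B.Decidable _~_)
             (~-sym : ∀ {x y} → x ~ y → y ~ x) (~-irrefl : ∀ {x} → ¬ x ~ x) where

  open Deletion _≟_

  private W = Walk _~_

  walk-++ : ∀ {x y z w xs ys} → W x y xs → y ~ z → W z w ys → W x w (xs ++ ys)
  walk-++ stop       e q = step e q
  walk-++ (step f p) e q = step f (walk-++ p e q)

  walk-reverse : ∀ {x y xs} → W x y xs → W y x (reverse xs)
  walk-reverse stop = stop
  walk-reverse (step {x = x} {xs = xs} e p) =
    subst (W _ _) (sym (unfold-reverse x xs)) (walk-++ (walk-reverse p) (~-sym e) stop)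

  walk-head : ∀ {x y xs} → W x y xs → x ∈ xs
  walk-head stop       = here refl
  walk-head (step _ _) = here refl

  walk-last : ∀ {x y xs} → W x y xs → y ∈ xs
  walk-last stop       = here refl
  walk-last (step _ p) = there (walk-last p)

  degree : List A → A → ℕ
  degree U x = count (x ~?_) U

  degree≤length : ∀ U x → degree U x ≤ length U
  degree≤length U x = ≤-trans (∑-bound 1 U λ {y} _ → ind≤1 (x ~? y)) (≤-reflexive (*-identityʳ _))

  degreeSum : List A → ℕ
  degreeSum U = ∑ (degree U) U

  record Path (U : List A) (m : ℕ) : Set where
    constructor path
    field
      {first last} : A
      vertices : List A
      walk     : W first last vertices
      unique   : Unique vertices
      inside   : ∀ {x} → x ∈ vertices → x ∈ U
      len      : length vertices ≡ suc m

  open Path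

  reversePath : ∀ {U m} → Path U m → Path U m
  reversePath p = path (reverse (vertices p)) (walk-reverse (walk p))
    (Unique-resp-↭ (↭-sym (↭-reverse _)) (unique p)) (inside p ∘ ∈-resp-↭ (↭-reverse _))
    (trans (length-reverse (vertices p)) (len p))

  extend : ∀ {U m} (p : Path U m) {y} → y ∈ U → y ∉ vertices p → first p ~ y → Path U (suc m)
  extend p {y} y∈ y∉ e = path (y ∷ vertices p) (step (~-sym e) (walk p))
    (All.tabulate (λ z∈ y≡z → y∉ (subst (_∈ _) (sym y≡z) z∈)) ∷ unique p)
    (λ { (here refl) → y∈ ; (there z∈) → inside p z∈ }) (cong suc (len p))

  -- Two consecutive positions u, w of the path with Q u and P w exist as soon as P and Q
  -- together hold more often than there are consecutive positions.
  consecutive : {P Q : Pred A 0ℓ} (P? : Decidable P) (Q? : Decidable Q) → ∀ {x y xs} → W x y xs →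
    length xs + (ind (P? x) + ind (Q? y)) ≤ count P? xs + count Q? xs →
    Σ (List A × List A) λ (ys , zs) → Σ (A × A) λ (u , w) →
      xs ≡ ys ++ zs × W x u ys × W w y zs × Q u × P w
  consecutive P? Q? {x} stop le = contradiction le (<⇒≱ (s≤s (≤-reflexive (zeros (ind (P? x)) (ind (Q? x))))))
    where
    zeros : ∀ a b → a + 0 + (b + 0) ≡ a + b
    zeros = solve-∀
  consecutive P? Q? {x} {y} (step {y = x′} {xs = xs} e p) le with Q? x in eqQ | P? x′ in eqP
  ... | yes q | yes r = ([ x ] , xs) , (x , x′) , refl , stop , p , q , r
  ... | yes q | no  ¬r = continue (arith (ind (P? x)) (ind (Q? y)) (length xs) (count P? xs) (count Q? xs) le)
    where
    arith : ∀ a b l c d → suc l + (a + b) ≤ (a + c) + (1 + d) → l + (0 + b) ≤ c + d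
    arith a b l c d h = +-cancelˡ-≤ (suc a) _ _ (subst₂ _≤_ (lhs a b l) (rhs a c d) h)
      where
      lhs : ∀ a b l → suc l + (a + b) ≡ suc a + (l + (0 + b))
      lhs = solve-∀
      rhs : ∀ a c d → (a + c) + (1 + d) ≡ suc a + (c + d)
      rhs = solve-∀
    continue : length xs + (0 + ind (Q? y)) ≤ count P? xs + count Q? xs → _
    continue le′ with consecutive P? Q? p (subst (λ z → length xs + (z + _) ≤ _) (sym (ind-no (P? x′) ¬r)) le′)
    ... | (ys , zs) , uw , refl , p₁ , p₂ , qp = (x ∷ ys , zs) , uw , refl , step e p₁ , p₂ , qp
  ... | no ¬q | d = continue (arith (ind (P? x)) (ind (Q? y)) (length xs) (count P? xs) (count Q? xs) le)
    where
    arith : ∀ a b l c d → suc l + (a + b) ≤ (a + c) + (0 + d) → suc (l + b) ≤ c + d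
    arith a b l c d h = +-cancelˡ-≤ a _ _ (subst₂ _≤_ (lhs a b l) (+-assoc a c d) h)
      where
      lhs : ∀ a b l → suc l + (a + b) ≡ a + suc (l + b)
      lhs = solve-∀
    bound : ∀ (i b l : ℕ) → i ≤ 1 → l + (i + b) ≤ suc (l + b)
    bound i b l i≤1 = ≤-trans (+-monoʳ-≤ l (+-monoˡ-≤ b i≤1)) (≤-reflexive (+-suc l b))
    continue : suc (length xs + ind (Q? y)) ≤ count P? xs + count Q? xs → _
    continue le′ with consecutive P? Q? p (≤-trans (bound _ (ind (Q? y)) (length xs) (ind≤1 (P? x′))) le′)
    ... | (ys , zs) , uw , refl , p₁ , p₂ , qp = (x ∷ ys , zs) , uw , refl , step e p₁ , p₂ , qp

  splitAt∈ : ∀ {x y v xs} → W x y xs → v ∈ xs →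
    x ≡ v ⊎ Σ (List A × List A × A) λ (ys , zs , u) → xs ≡ ys ++ zs × W x u ys × W v y zs
  splitAt∈ stop (here refl)       = inj₁ refl
  splitAt∈ (step e p) (here refl) = inj₁ refl
  splitAt∈ (step {x = x} e p) (there v∈) with splitAt∈ p v∈
  ... | inj₁ refl = inj₂ (([ x ] , _ , x) , refl , stop , p)
  ... | inj₂ ((ys , zs , u) , refl , p₁ , p₂) = inj₂ ((x ∷ ys , zs , u) , refl , step e p₁ , p₂)

  -- The edge from `y` to `x` closes the walk into a cycle, which is cut open just before `v`.
  rotate : ∀ {x y v xs} → W x y xs → y ~ x → v ∈ xs →
    Σ (List A × A) λ (zs , w) → zs ↭ xs × W v w zs
  rotate p y~x v∈ with splitAt∈ p v∈
  ... | inj₁ refl = _ , ↭-refl , p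
  ... | inj₂ ((ys , zs , u) , refl , p₁ , p₂) = (zs ++ ys , u) , ++-comm zs ys , walk-++ p₂ y~x p₁

  Escape : List A → A → List A → Set
  Escape U x xs = Σ A λ y → y ∈ U × x ~ y × y ∉ xs

  escape? : ∀ U x xs → Dec (Escape U x xs)
  escape? U x xs with Any.any? (λ y → (x ~? y) ×-dec ¬? (y ∈? xs)) U
  ... | yes a = let y , y∈ , e , y∉ = find a in yes (y , y∈ , e , y∉)
  ... | no ¬a = no λ (y , y∈ , e , y∉) → ¬a (lose y∈ (e , y∉))

  degree≤ : ∀ {U x xs} → Unique U → ¬ Escape U x xs → degree U x ≤ degree xs x
  degree≤ {U} {x} {xs} uU ¬esc = Unique⇒∑≤ xs uU λ {y} y∈ nz → stays y∈ nz
    where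
    stays : ∀ {y} → y ∈ U → ind (x ~? y) ≢ 0 → y ∈ xs
    stays {y} y∈ nz with y ∈? xs | x ~? y
    ... | yes y∈xs | _     = y∈xs
    ... | no y∉    | yes e = contradiction (y , y∈ , e , y∉) ¬esc
    ... | no y∉    | no ¬e = contradiction refl nz

  -- Dirac's argument: if neither end of the path can be extended, the vertices of the path
  -- span a cycle, which can be opened at any vertex with a neighbour off the path.
  lengthen : ∀ {U m l} → Unique U → (∀ {x} → x ∈ U → m < degree U x + degree U x) →
    l ≤ m → (p : Path U l) → ∀ {v} → v ∈ vertices p → Escape U v (vertices p) → Path U (suc l)
  lengthen {U} {m} {l} uU minDeg l≤m p {v} v∈ (w , w∈ , v~w , w∉)
    with escape? U (first p) (vertices p) | escape? U (last p) (vertices p)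
  ... | yes (y , y∈ , e , y∉) | _ = extend p y∈ y∉ e
  ... | no _ | yes (y , y∈ , e , y∉) =
    extend (reversePath p) y∈ (y∉ ∘ ∈-resp-↭ (↭-reverse _)) e
  ... | no ¬f | no ¬l = open-cycle (consecutive (first p ~?_) (last p ~?_) (walk p) enough)
    where
    xs = vertices p
    dF = degree xs (first p)
    dL = degree xs (last p)
    half : ∀ a b m → m < a + a → m < b + b → m < a + b
    half a b m p q with ≤-total a b
    ... | inj₁ a≤b = <-≤-trans p (+-monoʳ-≤ a a≤b)
    ... | inj₂ b≤a = <-≤-trans q (+-monoˡ-≤ b b≤a)
    big : suc l ≤ dF + dL
    big = ≤-trans (s≤s l≤m) (half dF dL m
      (<-≤-trans (minDeg (inside p (walk-head (walk p)))) (+-mono-≤ (degree≤ uU ¬f) (degree≤ uU ¬f)))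
      (<-≤-trans (minDeg (inside p (walk-last (walk p)))) (+-mono-≤ (degree≤ uU ¬l) (degree≤ uU ¬l))))
    enough : length xs + (ind (first p ~? first p) + ind (last p ~? last p)) ≤ dF + dL
    enough rewrite ind-no (first p ~? first p) ~-irrefl | ind-no (last p ~? last p) ~-irrefl
                 | +-identityʳ (length xs) | len p = big
    open-cycle : (Σ (List A × List A) λ (ys , zs) → Σ (A × A) λ (u , w) →
      xs ≡ ys ++ zs × W (first p) u ys × W w (last p) zs × last p ~ u × first p ~ w) → Path U (suc l)
    open-cycle ((ys , zs) , (u , w′) , eq , p₁ , p₂ , e , f) = extend q w∈ w∉q v~w
      where
      cycle↭ : ys ++ reverse zs ↭ xs
      cycle↭ = subst (_ ↭_) (sym eq) (++⁺ˡ ys (↭-reverse zs))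
      rot = rotate (walk-++ p₁ (~-sym e) (walk-reverse p₂)) (~-sym f) (∈-resp-↭ (↭-sym cycle↭) v∈)
      rot↭ : proj₁ (proj₁ rot) ↭ xs
      rot↭ = ↭-trans (proj₁ (proj₂ rot)) cycle↭
      q : Path U l
      q = path (proj₁ (proj₁ rot)) (proj₂ (proj₂ rot)) (Unique-resp-↭ (↭-sym rot↭) (unique p))
               (inside p ∘ ∈-resp-↭ rot↭) (trans (↭-length rot↭) (len p))
      w∉q : w ∉ vertices q
      w∉q = w∉ ∘ ∈-resp-↭ rot↭

  weaken : ∀ {U V m} → (∀ {x} → x ∈ U → x ∈ V) → Path U m → Path V m
  weaken h (path xs w u i l) = path xs w u (h ∘ i) l

  module _ {D : Pred A 0ℓ} (D? : Decidable D) (U : List A) where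
    kept    = filter (λ x → ¬? (D? x)) U
    removed = filter D? U

    degree-split : ∀ y → degree U y ≡ degree kept y + degree removed y
    degree-split y = ∑-partition D? _ U

    cross : ∑ (degree removed) kept ≡ ∑ (degree kept) removed
    cross = trans (∑-swap (λ x y → ind (x ~? y)) kept removed)
      (∑-cong removed λ {y} _ → ∑-cong kept λ {x} _ →
        ≤-antisym (ind-mono (x ~? y) (y ~? x) ~-sym) (ind-mono (y ~? x) (x ~? y) ~-sym))

    -- An edge between the two parts is lost at both of its ends; the end that is kept accounts for
    -- the extra `degree kept y`.
    degreeSum-split : degreeSum U ≡ degreeSum kept + ∑ (λ y → degree kept y + degree U y) removed
    degreeSum-split = trans (∑-partition D? (degree U) U)
      (trans (cong (_+ ∑ (degree U) removed)
         (trans (∑-cong kept λ {x} _ → degree-split x)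
         (trans (∑-+ (degree kept) (degree removed) kept) (cong (degreeSum kept +_) cross))))
      (trans (+-assoc (degreeSum kept) (∑ (degree kept) removed) (∑ (degree U) removed))
        (cong (degreeSum kept +_) (sym (∑-+ (degree kept) (degree U) removed)))))

    -- Each removed vertex lowers `m * length U` by `m` and accounts for a loss of at most `m` in
    -- the degree sum.
    peel : ∀ m → (∀ {y} → y ∈ U → D y → degree kept y + degree U y ≤ m) →
      m * length U < degreeSum U → m * length kept < degreeSum kept
    peel m h lt = +-cancelʳ-< (length removed * m) _ _ (begin-strict
      m * length kept + length removed * m ≡⟨ cong (m * length kept +_) (*-comm (length removed) m) ⟩
      m * length kept + m * length removed ≡⟨ *-distribˡ-+ m (length kept) (length removed) ⟨
      m * (length kept + length removed)   ≡⟨ cong (m *_) (length-partition D? U) ⟨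
      m * length U                         <⟨ lt ⟩
      degreeSum U                          ≡⟨ degreeSum-split ⟩
      degreeSum kept + ∑ (λ y → degree kept y + degree U y) removed
        ≤⟨ +-monoʳ-≤ (degreeSum kept) (∑-bound m removed λ y∈ → let y∈U , Dy = ∈-filter⁻ D? {xs = U} y∈ in h y∈U Dy) ⟩
      degreeSum kept + length removed * m  ∎)
      where open ≤-Reasoning

    kept-shorter : ∀ {v} → v ∈ U → D v → length kept < length U
    kept-shorter v∈ Dv = subst (length kept <_) (sym (length-partition D? U))
      (subst (_≤ length kept + length removed) (+-comm (length kept) 1)
        (+-monoʳ-≤ (length kept) (∈-length (∈-filter⁺ D? v∈ Dv))))

  degreeSum-pos : ∀ U m → m < degreeSum U → ∃ (_∈ U)
  degreeSum-pos (x ∷ U) _ _ = x , here refl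

  degree<length : ∀ {x xs} → x ∈ xs → degree xs x < length xs
  degree<length {x} {y ∷ ys} (here refl) rewrite ind-no (x ~? x) ~-irrefl = s≤s (degree≤length ys x)
  degree<length {x} {y ∷ ys} (there p) = +-mono-≤-< (ind≤1 (x ~? y)) (degree<length p)

  -- Erdős–Gallai.  A vertex of degree at most m / 2, or a set of at most m + 1 vertices with
  -- no edge leaving it, can be deleted without losing the density hypothesis.
  erdős-gallai : ∀ m U → Unique U → m * length U < degreeSum U → Path U (suc m)
  erdős-gallai m U uU lt = go (length U) U ≤-refl uU lt
    where
    go : ∀ s U → length U ≤ s → Unique U → m * length U < degreeSum U → Path U (suc m)
    go zero [] _ _ lt = contradiction lt (<⇒≱ (s≤s z≤n))
    go (suc s) U U≤s uU lt with Any.any? (λ v → degree U v + degree U v ≤? m) U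
    ... | yes a = weaken (proj₁ ∘ ∈-filter⁻ (λ x → ¬? (x ≟ v)) {xs = U})
                    (go s (kept (_≟ v) U) (s≤s⁻¹ (≤-trans (kept-shorter (_≟ v) U v∈ refl) U≤s))
                      (UniqueP.filter⁺ (λ x → ¬? (x ≟ v)) uU)
                      (peel (_≟ v) U m low lt))
      where
      v = proj₁ (find a)
      v∈ = proj₁ (proj₂ (find a))
      low : ∀ {y} → y ∈ U → y ≡ v → degree (kept (_≟ v) U) y + degree U y ≤ m
      low _ refl = ≤-trans (+-monoˡ-≤ (degree U v) (∑-filter≤ (λ x → ¬? (x ≟ v)) _ U)) (proj₂ (proj₂ (find a)))
    ... | no ¬a = grow m (+-identityʳ m) (path [ x ] stop ([] ∷ []) (λ { (here refl) → x∈ }) refl)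
      where
      x = proj₁ (degreeSum-pos U _ lt)
      x∈ = proj₂ (degreeSum-pos U _ lt)
      minDeg : ∀ {x} → x ∈ U → m < degree U x + degree U x
      minDeg x∈ = ≰⇒> λ le → ¬a (lose x∈ le)
      grow : ∀ f {l} → f + l ≡ m → Path U l → Path U (suc m)
      grow f {l} f+l≡m p with Any.any? (λ v → escape? U v (vertices p)) (vertices p)
      grow zero    refl p | yes e = let _ , v∈ , esc = find e in lengthen uU minDeg ≤-refl p v∈ esc
      grow (suc f) {l} refl p | yes e = let _ , v∈ , esc = find e in
        grow f (+-suc f l) (lengthen uU minDeg (m≤n+m l (suc f)) p v∈ esc)
      grow f {l} f+l≡m p | no ¬e = weaken (proj₁ ∘ ∖-∈ U Q)
          (go s (U ∖ Q) (s≤s⁻¹ (≤-trans (kept-shorter (_∈? Q) U (inside p (walk-head (walk p))) (walk-head (walk p))) U≤s))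
            (∖-Unique Q uU) (peel (_∈? Q) U m closed lt))
        where
        Q = vertices p
        stuck : ∀ {y} → y ∈ Q → ¬ Escape U y Q
        stuck y∈ esc = ¬e (lose y∈ esc)
        closed : ∀ {y} → y ∈ U → y ∈ Q → degree (U ∖ Q) y + degree U y ≤ m
        closed {y} _ y∈Q = subst (λ z → z + degree U y ≤ m) (sym none)
          (≤-trans (degree≤ uU (stuck y∈Q))
            (≤-trans (s≤s⁻¹ (subst (degree Q y <_) (len p) (degree<length y∈Q)))
              (subst (l ≤_) f+l≡m (m≤n+m l f))))
          where
          none : degree (U ∖ Q) y ≡ 0
          none = trans (∑-cong (U ∖ Q) λ {z} z∈ → ind-no (y ~? z) λ e →
                   let z∈U , z∉Q = ∖-∈ U Q z∈ in stuck y∈Q (z , z∈U , e , z∉Q))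
                 (trans (∑-const 0 (U ∖ Q)) (*-zeroʳ (length (U ∖ Q))))

  -- Splitting off the first vertex exchanges the two sides, and with them the strict and the weak
  -- bound: the `m + 1` vertices alternate, and the side of the start receives the odd one. The
  -- final component controls the weight of the path under any function, in particular under the
  -- degree in another graph.
  zigzag : ∀ m ps qs → m < length ps + length ps → m ≤ length qs + length qs → Unique ps → Unique qs →
    (∀ {p} → p ∈ ps → p ∉ qs) → (∀ {p q} → p ∈ ps → q ∈ qs → p ~ q) →
    Σ (Path (ps ++ qs) m) λ w → first w ∈ ps × (∀ f → ∑ f (vertices w) ≤ ∑ f ps + ∑ f qs)
  zigzag zero (p ∷ ps) qs _ _ _ _ _ _ =
    path [ p ] stop ([] ∷ []) (λ { (here refl) → here refl }) refl , here refl ,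
    λ f → ≤-trans (+-monoʳ-≤ (f p) z≤n) (m≤m+n _ (∑ f qs))
  zigzag (suc m) (p ∷ ps) qs m< m≤ (p∉ ∷ ups) uqs dis com
    with zigzag m qs ps m≤ m≤′ uqs ups (λ q∈ p∈ → dis (there p∈) q∈) (λ q∈ p∈ → ~-sym (com (there p∈) q∈))
    where
    m≤′ : m ≤ length ps + length ps
    m≤′ = +-cancelˡ-≤ 2 _ _ (≤-trans m< (≤-reflexive (cong suc (+-suc (length ps) (length ps)))))
  ... | path vs w u ins l , f∈ , sums =
    path (p ∷ vs) (step (com (here refl) f∈) w)
      (All.tabulate (λ {v} v∈ p≡v → fresh v∈ (sym p≡v)) ∷ u)
      (λ { (here refl) → here refl ; (there v∈) → there (back (∈-++⁻ qs (ins v∈))) }) (cong suc l)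
    , here refl
    , λ f → ≤-trans (+-monoʳ-≤ (f p) (sums f)) (≤-reflexive (exch (f p) (∑ f qs) (∑ f ps)))
    where
    exch : ∀ a b c → a + (b + c) ≡ a + c + b
    exch = solve-∀
    back : ∀ {v} → v ∈ qs ⊎ v ∈ ps → v ∈ ps ++ qs
    back (inj₁ q∈) = ∈-++⁺ʳ ps q∈
    back (inj₂ p∈) = ∈-++⁺ˡ p∈
    fresh : ∀ {v} → v ∈ vs → v ≢ p
    fresh v∈ refl with ∈-++⁻ qs (ins v∈)
    ... | inj₁ q∈ = dis (here refl) q∈
    ... | inj₂ p∈ = All.lookup p∉ p∈ refl

  dropLast : ∀ {U m} (p : Path U (suc m)) →
    Σ (Path U m) λ q → first q ≡ first p × (∀ {x} → x ∈ vertices q → x ∈ vertices p)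
  dropLast (path vs w u i l) = go w u i l
    where
    go : ∀ {U m x y vs} (w : Walk _~_ x y vs) → Unique vs → (∀ {z} → z ∈ vs → z ∈ U) → length vs ≡ 2 + m →
      Σ (Path U m) λ q → first q ≡ x × (∀ {z} → z ∈ vertices q → z ∈ vs)
    go {m = zero} (step {x = x} _ _) _ i _ =
      path [ x ] stop ([] ∷ []) (λ { (here refl) → i (here refl) }) refl , refl , λ { (here refl) → here refl }
    go {m = suc m} (step {x = x} e w) (x∉ ∷ u) i l with go w u (i ∘ there) (suc-injective l)
    ... | path vs′ w′ u′ i′ l′ , refl , sub =
      path (x ∷ vs′) (step e w′) (All.tabulate (All.lookup x∉ ∘ sub) ∷ u′)
        (λ { (here refl) → i (here refl) ; (there z∈) → i′ z∈ }) (cong suc l′) ,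
      refl , λ { (here refl) → here refl ; (there z∈) → there (sub z∈) }

  open Biclique

  -- A path with suc k edges, only suc h ≈ (k + 1) / 2 of whose vertices lie in H: Erdős–Gallai applies
  -- outside H unless the edges at H are dense, and then H and its complement span a biclique.
  lightPath : ∀ {V} k h c H → suc k ≤ suc h + suc h → h + h ≤ k → Unique V → length H ≤ c →
    (suc k + suc k) * length V ≤ degreeSum V → c * c + 2 * (c * (2 ^ c * (2 + k))) < 2 * length V →
    Σ (Path V (suc k)) λ p → first p ∉ H ×
      (∀ f a b → (∀ x → f x ≤ a) → (∀ {x} → x ∈ V → x ∉ H → f x ≤ b) →
        ∑ f (vertices p) ≤ suc h * a + (2 + k) * b)
  lightPath {V} k h c H k≤ h≤ uV H≤c dense large with k * length (V ∖ H) <? degreeSum (V ∖ H)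
  ... | yes lt = weaken (proj₁ ∘ ∖-∈ V H) p , proj₂ (∖-∈ V H (inside p (walk-head (walk p)))) , light
    where
    p = erdős-gallai k (V ∖ H) (∖-Unique H uV) lt
    -- In the application `f` is the degree in the other colour, `a` the number of vertices and `b`
    -- the cut-off for low degrees, so that this bounds what deleting the path costs the other
    -- colour.
    light : ∀ f a b → (∀ x → f x ≤ a) → (∀ {x} → x ∈ V → x ∉ H → f x ≤ b) →
      ∑ f (vertices p) ≤ suc h * a + (2 + k) * b
    light f a b _ low = ≤-trans (∑-bound b (vertices p) λ x∈ → let x∈V , x∉H = ∖-∈ V H (inside p x∈) in low x∈V x∉H)
      (≤-trans (≤-reflexive (cong (_* b) (len p))) (m≤n+m _ (suc h * a)))
  ... | no ≮ = weaken into-V (proj₁ zz) , (λ f∈H → proj₂ (leaf-∈ (proj₁ (proj₂ zz))) f∈H) , light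
    where
    open ≤-Reasoning
    n = length V
    V₁ = V ∖ H
    V₂ = filter (_∈? H) V
    V₂≤c : length V₂ ≤ c
    V₂≤c = ≤-trans (Unique⇒length≤ H (UniqueP.filter⁺ (_∈? H) uV) (proj₂ ∘ ∈-filter⁻ (_∈? H) {xs = V})) H≤c
    e = ∑ (degree V₁) V₂
    D = c * (2 ^ c * (2 + k))
    V₁≤ : length V₁ ≤ n
    V₁≤ = ≤-trans (m≤m+n _ _) (≤-reflexive (sym (length-partition (_∈? H) V)))
    upper : degreeSum V ≤ k * n + (e + e) + c * c
    upper = begin
      degreeSum V ≡⟨ degreeSum-split (_∈? H) V ⟩
      degreeSum V₁ + ∑ (λ y → degree V₁ y + degree V y) V₂
        ≤⟨ +-mono-≤ (≤-trans (≮⇒≥ ≮) (*-monoʳ-≤ k V₁≤)) (∑-mono V₂ λ {y} _ → +-monoʳ-≤ (degree V₁ y)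
             (≤-trans (≤-reflexive (degree-split (_∈? H) V y)) (+-monoʳ-≤ (degree V₁ y) (≤-trans (degree≤length V₂ y) V₂≤c)))) ⟩
      k * n + ∑ (λ y → degree V₁ y + (degree V₁ y + c)) V₂
        ≡⟨ cong (k * n +_) (trans (∑-+ (degree V₁) _ V₂) (cong (e +_) (trans (∑-+ (degree V₁) _ V₂) (cong (e +_) (∑-const c V₂))))) ⟩
      k * n + (e + (e + length V₂ * c)) ≤⟨ +-monoʳ-≤ (k * n) (+-monoʳ-≤ e (+-monoʳ-≤ e (*-monoˡ-≤ c V₂≤c))) ⟩
      k * n + (e + (e + c * c)) ≡⟨ assoc (k * n) e (c * c) ⟩
      k * n + (e + e) + c * c ∎
      where
      assoc : ∀ a b c → a + (b + (b + c)) ≡ a + (b + b) + c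
      assoc = solve-∀
    -- Otherwise the degree sum would be at most kn + 2hn plus a constant. Since 2h is at most k,
    -- the assumed 2(k + 1)n leaves 2n to beat that constant.
    many : h * length V₁ + D < e
    many = ≰⇒> λ e≤ → <⇒≱ (begin-strict
      degreeSum V ≤⟨ upper ⟩
      k * n + (e + e) + c * c ≤⟨ +-monoˡ-≤ (c * c) (+-monoʳ-≤ (k * n) (+-mono-≤ (bound e≤) (bound e≤))) ⟩
      k * n + ((h * n + D) + (h * n + D)) + c * c ≡⟨ regroup k n h D (c * c) ⟩
      k * n + (h + h) * n + (c * c + 2 * D) ≤⟨ +-monoˡ-≤ (c * c + 2 * D) (+-monoʳ-≤ (k * n) (*-monoˡ-≤ n h≤)) ⟩
      k * n + k * n + (c * c + 2 * D) <⟨ +-monoʳ-< (k * n + k * n) large ⟩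
      k * n + k * n + 2 * n ≡⟨ collect k n ⟩
      (suc k + suc k) * n ∎) dense
      where
      bound : e ≤ h * length V₁ + D → e ≤ h * n + D
      bound e≤ = ≤-trans e≤ (+-monoˡ-≤ D (*-monoʳ-≤ h V₁≤))
      regroup : ∀ k n h d c → k * n + ((h * n + d) + (h * n + d)) + c ≡ k * n + (h + h) * n + (c + 2 * d)
      regroup = solve-∀
      collect : ∀ k n → k * n + k * n + 2 * n ≡ (suc k + suc k) * n
      collect = solve-∀
    bc : Biclique _~_ V₂ V₁ (suc h) (2 + k)
    bc = biclique-of-sum _~?_ c h (2 + k) (UniqueP.filter⁺ (_∈? H) uV) (∖-Unique H uV) V₂≤c (s≤s z≤n)
           (subst (h * length V₁ + D <_) (sym (∑-swap (λ x y → ind (y ~? x)) V₁ V₂)) many)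
    leaf-∈ : ∀ {x} → x ∈ right bc → x ∈ V × x ∉ H
    leaf-∈ x∈ = ∖-∈ V H (right⊆ bc x∈)
    centre-∈ : ∀ {x} → x ∈ left bc → x ∈ V × x ∈ H
    centre-∈ x∈ = ∈-filter⁻ (_∈? H) {xs = V} (left⊆ bc x∈)
    -- Starting among the leaves puts the first vertex outside `H`; `suc h` centres are enough
    -- because of `suc k ≤ suc h + suc h`.
    zz = zigzag (suc k) (right bc) (left bc)
      (subst (λ l → suc k < l + l) (sym (right-length bc)) (m≤m+n (2 + k) (2 + k)))
      (subst (λ l → suc k ≤ l + l) (sym (left-length bc)) k≤)
      (right-unique bc) (left-unique bc) (λ x∈ x∈′ → proj₂ (leaf-∈ x∈) (proj₂ (centre-∈ x∈′)))
      (λ x∈ y∈ → ~-sym (complete bc y∈ x∈))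
    into-V : ∀ {x} → x ∈ right bc ++ left bc → x ∈ V
    into-V x∈ with ∈-++⁻ (right bc) x∈
    ... | inj₁ p = proj₁ (leaf-∈ p)
    ... | inj₂ p = proj₁ (centre-∈ p)
    light : ∀ f a b → (∀ x → f x ≤ a) → (∀ {x} → x ∈ V → x ∉ H → f x ≤ b) →
      ∑ f (vertices (proj₁ zz)) ≤ suc h * a + (2 + k) * b
    light f a b high low = begin
      ∑ f (vertices (proj₁ zz)) ≤⟨ proj₂ (proj₂ zz) f ⟩
      ∑ f (right bc) + ∑ f (left bc) ≤⟨ +-mono-≤ (∑-bound b (right bc) λ x∈ → let x∈V , x∉H = leaf-∈ x∈ in low x∈V x∉H)
                                                  (∑-bound a (left bc) λ {x} _ → high x) ⟩
      length (right bc) * b + length (left bc) * a ≡⟨ cong₂ (λ l m → l * b + m * a) (right-length bc) (left-length bc) ⟩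
      (2 + k) * b + suc h * a ≡⟨ +-comm ((2 + k) * b) (suc h * a) ⟩
      suc h * a + (2 + k) * b ∎

-- Vertex-disjoint paths in two dense graphs

m<suc[m/n]*n : ∀ m d → m < suc (m / suc d) * suc d
m<suc[m/n]*n m d = begin-strict
  m                                  ≡⟨ m≡m%n+[m/n]*n m (suc d) ⟩
  m % suc d + m / suc d * suc d      <⟨ +-monoˡ-< (m / suc d * suc d) (m%n<n m (suc d)) ⟩
  suc d + m / suc d * suc d          ∎
  where open ≤-Reasoning

-- The additive error in `lightPath`: `c * c` for degrees inside `H`, and twice the error term of
-- `biclique-of-sum`.
lightBound : ℕ → ℕ → ℕ
lightBound k c = c * c + 2 * (c * (2 ^ c * (2 + k)))

lightBound-mono : ∀ k {c c′} → c ≤ c′ → lightBound k c ≤ lightBound k c′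
lightBound-mono k c≤ = +-mono-≤ (*-mono-≤ c≤ c≤)
  (*-monoʳ-≤ 2 (*-mono-≤ c≤ (*-monoˡ-≤ (2 + k) (^-monoʳ-≤ 2 c≤))))

-- n / suc (scale k t b) separates low from high degrees; hubs k t b high-degree vertices
-- are enough to find a large biclique.
scale hubs leafCount pathThreshold : ℕ → ℕ → ℕ → ℕ
-- Chosen so that `suc (scale k t b)` unfolds to `2 * (2 + k + b) * suc t`. Deleting 2 + k + b
-- vertices of low degree then lowers a degree sum by at most n / (t + 1).
scale k t b = t + suc (k + b + (2 + k + b + 0)) * suc t
-- So many degrees above `n / suc (scale k t b)` add up to at least `suc (⌊ k /2⌋ + (2 + k))` times
-- `n`. The biclique then has `2 + k` centres for the first path to cover and `suc ⌊ k /2⌋` more for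
-- a zigzag.
hubs k t b = suc (scale k t b) * suc (⌊ k /2⌋ + (2 + k))
leafCount k t b = hubs k t b + b + (2 + k) + (2 + k)
pathThreshold k t b = lightBound k (hubs k t b + b) + hubs k t b * (2 ^ hubs k t b * leafCount k t b)
  + (b + (2 + k) + (2 + k)) * suc (scale k t b)

lightBound≤pathThreshold : ∀ k t b → lightBound k (hubs k t b + b) ≤ pathThreshold k t b
lightBound≤pathThreshold k t b = ≤-trans (m≤m+n (lightBound k (hubs k t b + b)) _) (m≤m+n _ _)

hubs≤pathThreshold : ∀ k t b → hubs k t b * (2 ^ hubs k t b * leafCount k t b) ≤ pathThreshold k t b
hubs≤pathThreshold k t b = ≤-trans (m≤n+m _ (lightBound k (hubs k t b + b))) (m≤m+n _ _)

scale≤pathThreshold : ∀ k t b → (b + (2 + k) + (2 + k)) * suc (scale k t b) ≤ pathThreshold k t b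
scale≤pathThreshold k t b = m≤n+m ((b + (2 + k) + (2 + k)) * suc (scale k t b)) _

dense⇒2k≤ : ∀ k t n d → 2 * (suc k * suc t + 1) * n ≤ suc t * d → (suc k + suc k) * n ≤ d
dense⇒2k≤ k t n d dense = *-cancelˡ-≤ (suc t) (≤-trans (≤-trans (m≤m+n _ (2 * n)) (≤-reflexive (expand k (suc t) n))) dense)
  where
  expand : ∀ k t n → t * ((suc k + suc k) * n) + 2 * n ≡ 2 * (suc k * t + 1) * n
  expand = solve-∀

halves≤ : ∀ k → ⌊ k /2⌋ + ⌊ k /2⌋ ≤ k
halves≤ k = ≤-trans (+-monoʳ-≤ ⌊ k /2⌋ (⌊n/2⌋≤⌈n/2⌉ k)) (≤-reflexive (⌊n/2⌋+⌈n/2⌉≡n k))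

≤halves : ∀ k → suc k ≤ suc ⌊ k /2⌋ + suc ⌊ k /2⌋
≤halves k = s≤s (≤-trans (≤-reflexive (sym (⌊n/2⌋+⌈n/2⌉≡n k))) (+-monoʳ-≤ ⌊ k /2⌋ (⌊n/2⌋-mono (n≤1+n (suc k)))))

module DisjointPaths {A : Set} (_≟_ : DecidableEquality A)
  (_~₁_ : Rel A 0ℓ) (_~₁?_ : B.Decidable _~₁_) (~₁-sym : ∀ {x y} → x ~₁ y → y ~₁ x) (~₁-irrefl : ∀ {x} → ¬ x ~₁ x)
  (_~₂_ : Rel A 0ℓ) (_~₂?_ : B.Decidable _~₂_) (~₂-sym : ∀ {x y} → x ~₂ y → y ~₂ x) (~₂-irrefl : ∀ {x} → ¬ x ~₂ x) where

  open Deletion _≟_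
  module G₁ = Graph _≟_ _~₁_ _~₁?_ ~₁-sym ~₁-irrefl
  module G₂ = Graph _≟_ _~₂_ _~₂?_ ~₂-sym ~₂-irrefl
  open Graph.Path
  open Biclique

  DisjointPair : List A → List A → ℕ → Set
  DisjointPair V S m = Σ (G₁.Path V m) λ p → Σ (G₂.Path V m) λ q →
    first p ∉ S × first q ∉ S × (∀ {x} → x ∈ vertices p → x ∉ vertices q)

  -- The biclique of the second colour is too large to be spoilt by any first path: that path covers
  -- at most `2 + k` centres, and there are enough leaves to discard `H`, `S` and the whole path.
  disjoint-of-biclique : ∀ {V H} k h c r S → suc k ≤ suc h + suc h → h + h ≤ k → Unique V → (∀ {x} → x ∈ H → x ∈ V) →
    (suc k + suc k) * length V ≤ G₁.degreeSum V →
    length S * length S + 2 * (length S * (2 ^ length S * (2 + k))) < 2 * length V →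
    length H ≡ c → c + length S + (2 + k) + (2 + k) ≤ r → Biclique _~₂_ H V (suc h + (2 + k)) r → DisjointPair V S (suc k)
  disjoint-of-biclique {V} {H} k h c r S k≤ h≤ uV H⊆ dense large H≡c r≥ bc =
    p , G₂.weaken into-V (proj₁ zz) , proj₁ (proj₂ light) ,
    (λ f∈ → leaf∉ (proj₁ (proj₂ zz)) (∈-++⁺ʳ H (∈-++⁺ˡ f∈))) , disjoint
    where
    light = G₁.lightPath {V} k h (length S) S k≤ h≤ uV ≤-refl dense large
    p = proj₁ light
    P = vertices p
    avoid = H ++ (S ++ P)
    leaves = right bc ∖ avoid
    centres = left bc ∖ P
    leaf∉ : ∀ {x} → x ∈ leaves → x ∉ avoid
    leaf∉ x∈ = proj₂ (∖-∈ (right bc) avoid x∈)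
    open ≤-Reasoning
    leaves≥ : 2 + k ≤ length leaves
    leaves≥ = +-cancelʳ-≤ (c + (length S + (2 + k))) _ _ (begin
      (2 + k) + (c + (length S + (2 + k)))  ≡⟨ shuffle c (length S) (2 + k) ⟩
      c + length S + (2 + k) + (2 + k)      ≤⟨ r≥ ⟩
      r                                     ≡⟨ right-length bc ⟨
      length (right bc)                     ≤⟨ length-∖ avoid (right-unique bc) ⟩
      length leaves + length avoid          ≡⟨ cong (length leaves +_) (trans (length-++ H) (cong₂ _+_ H≡c
                                                (trans (length-++ S) (cong (length S +_) (len p))))) ⟩
      length leaves + (c + (length S + (2 + k))) ∎)
      where
      shuffle : ∀ a b c → c + (a + (b + c)) ≡ a + b + c + c
      shuffle = solve-∀
    centres≥ : suc h ≤ length centres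
    centres≥ = +-cancelʳ-≤ (2 + k) _ _ (begin
      suc h + (2 + k)                       ≡⟨ left-length bc ⟨
      length (left bc)                      ≤⟨ length-∖ P (left-unique bc) ⟩
      length centres + length P             ≡⟨ cong (length centres +_) (len p) ⟩
      length centres + (2 + k) ∎)
    zz = G₂.zigzag (suc k) leaves centres
      (≤-trans leaves≥ (m≤m+n _ _)) (≤-trans k≤ (+-mono-≤ centres≥ centres≥))
      (∖-Unique avoid (right-unique bc)) (∖-Unique P (left-unique bc))
      (λ x∈ x∈′ → leaf∉ x∈ (∈-++⁺ˡ (left⊆ bc (proj₁ (∖-∈ (left bc) P x∈′)))))
      (λ x∈ y∈ → ~₂-sym (complete bc (proj₁ (∖-∈ (left bc) P y∈)) (proj₁ (∖-∈ (right bc) avoid x∈))))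
    into-V : ∀ {x} → x ∈ leaves ++ centres → x ∈ V
    into-V x∈ with ∈-++⁻ leaves x∈
    ... | inj₁ x∈l = right⊆ bc (proj₁ (∖-∈ (right bc) avoid x∈l))
    ... | inj₂ x∈c = H⊆ (left⊆ bc (proj₁ (∖-∈ (left bc) P x∈c)))
    disjoint : ∀ {x} → x ∈ P → x ∉ vertices (proj₁ zz)
    disjoint x∈ x∈q with ∈-++⁻ leaves (inside (proj₁ zz) x∈q)
    ... | inj₁ x∈l = leaf∉ x∈l (∈-++⁺ʳ H (∈-++⁺ʳ S x∈))
    ... | inj₂ x∈c = proj₂ (∖-∈ (left bc) P x∈c) x∈

  -- A start of high degree has a neighbour outside `S` and both paths; prepending it and dropping
  -- the last vertex keeps the length. Starts of low degree never require this repair, since the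
  -- low-degree part of `S` is deleted before the second path is chosen.
  avoidStart : ∀ {V S m w} (p : G₁.Path V (suc m)) → Unique V → length S + (2 + m) + (2 + m) ≤ w →
    first p ∉ S → (q : G₂.Path V (suc m)) → (∀ {x} → x ∈ vertices p → x ∉ vertices q) →
    (first q ∈ S → w < G₂.degree V (first q)) → DisjointPair V S (suc m)
  avoidStart {V} {S} {m} {w} p uV w≥ f∉ q dis high with first q ∈? S
  ... | no f∉S = p , q , f∉ , f∉S , dis
  ... | yes f∈S with G₂.escape? V (first q) (S ++ vertices p ++ vertices q)
  ...   | no ¬esc = contradiction (high f∈S) (≤⇒≯ (≤-trans (G₂.degree≤ uV ¬esc) (≤-trans (G₂.degree≤length (S ++ vertices p ++ vertices q) (first q)) (≤-trans (≤-reflexive size) w≥))))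
    where
    size : length (S ++ vertices p ++ vertices q) ≡ length S + (2 + m) + (2 + m)
    size = trans (length-++ S) (trans (cong (length S +_) (trans (length-++ (vertices p)) (cong₂ _+_ (len p) (len q)))) (sym (+-assoc (length S) (2 + m) (2 + m))))
  ...   | yes (x , x∈V , e , x∉) with G₂.dropLast (G₂.extend q x∈V (λ x∈ → x∉ (∈-++⁺ʳ S (∈-++⁺ʳ (vertices p) x∈))) e)
  ...     | q′ , f≡ , sub = p , q′ , f∉ , (λ f∈ → x∉ (∈-++⁺ˡ (subst (_∈ S) f≡ f∈))) , dis′
    where
    dis′ : ∀ {z} → z ∈ vertices p → z ∉ vertices q′
    dis′ z∈p z∈q′ with sub z∈q′
    ... | here refl = x∉ (∈-++⁺ʳ S (∈-++⁺ˡ z∈p))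
    ... | there z∈q = dis z∈p z∈q

  -- Deleting `p` and the low-degree part of `S` lowers the second degree sum by at most 2(h + 1)n +
  -- n / (t + 1), hence by at most (k + 2)n + n / (t + 1). From 2(k + 1)n + 2n / (t + 1) more than
  -- kn remains, which is what Erdős-Gallai needs.
  disjoint-of-light : ∀ {V S} k h t w → suc k ≤ suc h + suc h → h + h ≤ k → Unique V → 0 < length V →
    2 * (suc k * suc t + 1) * length V ≤ suc t * G₂.degreeSum V →
    2 * (2 + k + length S) * suc t * w ≤ length V →
    length S + (2 + k) + (2 + k) ≤ w →
    (p : G₁.Path V (suc k)) → first p ∉ S →
    ∑ (G₂.degree V) (vertices p) ≤ suc h * length V + (2 + k) * w → DisjointPair V S (suc k)
  disjoint-of-light {V} {S} k h t w k≤ h≤ uV 0<n dense w≤ w≥ p f∉ light =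
    avoidStart p uV w≥ f∉ (G₂.weaken (proj₁ ∘ ∖-∈ V R) q)
      (λ x∈p x∈q → proj₂ (∖-∈ V R (inside q x∈q)) (∈-++⁺ˡ x∈p))
      (λ f∈S → ≰⇒> λ low → proj₂ (∖-∈ V R (inside q (G₂.walk-head (walk q))))
         (∈-++⁺ʳ P (∈-filter⁺ low? f∈S low)))
    where
    open ≤-Reasoning
    n = length V
    P = vertices p
    low? : Decidable (λ x → G₂.degree V x ≤ w)
    low? x = G₂.degree V x ≤? w
    L = filter low? S
    R = P ++ L
    V′ = V ∖ R
    d : A → ℕ
    d = G₂.degree V
    L≤ : length L ≤ length S
    L≤ = ≤-trans (m≤n+m _ _) (≤-reflexive (sym (length-partition low? S)))
    loss : ∑ (λ y → G₂.degree V′ y + d y) (filter (_∈? R) V) ≤ 2 * (suc h * n + (2 + k + length S) * w)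
    loss = begin
      ∑ (λ y → G₂.degree V′ y + d y) (filter (_∈? R) V)
        ≤⟨ ∑-mono (filter (_∈? R) V) (λ {y} _ → +-monoˡ-≤ (d y) (∑-filter≤ (λ x → ¬? (x ∈? R)) (λ z → ind (y ~₂? z)) V)) ⟩
      ∑ (λ y → d y + d y) (filter (_∈? R) V)
        ≤⟨ Unique⇒∑≤ R (UniqueP.filter⁺ (_∈? R) uV) (λ y∈ _ → proj₂ (∈-filter⁻ (_∈? R) {xs = V} y∈)) ⟩
      ∑ (λ y → d y + d y) R      ≡⟨ ∑-+ d d R ⟩
      ∑ d R + ∑ d R              ≤⟨ +-mono-≤ once once ⟩
      (suc h * n + (2 + k + length S) * w) + (suc h * n + (2 + k + length S) * w) ≡⟨ double (suc h * n + (2 + k + length S) * w) ⟩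
      2 * (suc h * n + (2 + k + length S) * w) ∎
      where
      double : ∀ a → a + a ≡ 2 * a
      double = solve-∀
      assoc : ∀ a k w s → a + (2 + k) * w + s * w ≡ a + (2 + k + s) * w
      assoc = solve-∀
      once : ∑ d R ≤ suc h * n + (2 + k + length S) * w
      once = begin
        ∑ d R                                   ≡⟨ ∑-++ d P L ⟩
        ∑ d P + ∑ d L                           ≤⟨ +-mono-≤ light (≤-trans (∑-bound w L (proj₂ ∘ ∈-filter⁻ low? {xs = S})) (*-monoˡ-≤ w L≤)) ⟩
        suc h * n + (2 + k) * w + length S * w  ≡⟨ assoc (suc h * n) k w (length S) ⟩
        suc h * n + (2 + k + length S) * w      ∎
    rest : k * n < G₂.degreeSum V′
    rest = ≰⇒> λ le → <⇒≱ (begin-strict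
      suc t * G₂.degreeSum V
        ≤⟨ *-monoʳ-≤ (suc t) (≤-trans (≤-reflexive (G₂.degreeSum-split (_∈? R) V)) (+-mono-≤ le loss)) ⟩
      suc t * (k * n + 2 * (suc h * n + (2 + k + length S) * w))
        ≡⟨ expand (suc t) k n h (2 + k + length S) w ⟩
      suc t * (k * n) + suc t * ((h + h) * n) + suc t * (2 * n) + 2 * (2 + k + length S) * suc t * w
        ≤⟨ +-mono-≤ (+-monoˡ-≤ (suc t * (2 * n)) (+-monoʳ-≤ (suc t * (k * n)) (*-monoʳ-≤ (suc t) (*-monoˡ-≤ n h≤)))) w≤ ⟩
      suc t * (k * n) + suc t * (k * n) + suc t * (2 * n) + n
        <⟨ +-monoʳ-< (suc t * (k * n) + suc t * (k * n) + suc t * (2 * n)) (m<m+n n 0<n) ⟩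
      suc t * (k * n) + suc t * (k * n) + suc t * (2 * n) + (n + n)
        ≡⟨ collect (suc t) k n ⟩
      2 * (suc k * suc t + 1) * n ∎) dense
      where
      expand : ∀ t k n h r w → t * (k * n + 2 * (suc h * n + r * w)) ≡
        t * (k * n) + t * ((h + h) * n) + t * (2 * n) + 2 * r * t * w
      expand = solve-∀
      collect : ∀ t k n → t * (k * n) + t * (k * n) + t * (2 * n) + (n + n) ≡ 2 * (suc k * t + 1) * n
      collect = solve-∀
    q : G₂.Path V′ (suc k)
    q = G₂.erdős-gallai k V′ (∖-Unique R uV) (≤-<-trans
      (*-monoʳ-≤ k (≤-trans (m≤m+n _ _) (≤-reflexive (sym (length-partition (_∈? R) V))))) rest)

  -- The split is by the number of vertices of linear degree in the second graph. Many of them yield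
  -- a biclique that survives the deletion of any first path; if they are few, the first path can be
  -- chosen to use few of them.
  disjointPaths : ∀ {V} k t b S → length S ≤ b → Unique V → pathThreshold k t b < length V →
    2 * (suc k * suc t + 1) * length V ≤ suc t * G₁.degreeSum V →
    2 * (suc k * suc t + 1) * length V ≤ suc t * G₂.degreeSum V → DisjointPair V S (suc k)
  disjointPaths {V} k t b S S≤b uV large dense₁ dense₂ with hubs k t b ≤? length H
    where
    H = filter (λ x → length V / suc (scale k t b) <? G₂.degree V x) V
  ... | yes C≤ = disjoint-of-biclique k ⌊ k /2⌋ (hubs k t b) (leafCount k t b) S (≤halves k) (halves≤ k) uV
          H′⊆ (dense⇒2k≤ k t (length V) (G₁.degreeSum V) dense₁) (≤-<-trans (lightBound-mono k (≤-trans S≤b (m≤n+m b (hubs k t b)))) light<)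
          H′-length (+-monoˡ-≤ (2 + k) (+-monoˡ-≤ (2 + k) (+-monoʳ-≤ C S≤b))) bc
    where
    open ≤-Reasoning
    n = length V
    C = hubs k t b
    s = ⌊ k /2⌋ + (2 + k)
    w = n / suc (scale k t b)
    H = filter (λ x → w <? G₂.degree V x) V
    H′ = take C H
    H′-length : length H′ ≡ C
    H′-length = length-take≡ C H C≤
    H′-∈ : ∀ {x} → x ∈ H′ → x ∈ V × w < G₂.degree V x
    H′-∈ x∈ = ∈-filter⁻ (λ x → w <? G₂.degree V x) {xs = V} (∈-take C x∈)
    H′⊆ : ∀ {x} → x ∈ H′ → x ∈ V
    H′⊆ = proj₁ ∘ H′-∈
    light< : lightBound k (C + b) < 2 * n
    light< = <-≤-trans (≤-<-trans (lightBound≤pathThreshold k t b) large) (m≤m+n n (n + 0))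
    many : s * n + C * (2 ^ C * leafCount k t b) < ∑ (λ x → count (λ h → h ~₂? x) H′) V
    many = begin-strict
      s * n + C * (2 ^ C * leafCount k t b) <⟨ +-monoʳ-< (s * n) (≤-<-trans (hubs≤pathThreshold k t b) large) ⟩
      s * n + n                             ≡⟨ +-comm (s * n) n ⟩
      suc s * n                             ≤⟨ *-monoʳ-≤ (suc s) (<⇒≤ (m<suc[m/n]*n n (scale k t b))) ⟩
      suc s * (suc w * suc (scale k t b))   ≡⟨ reorder (suc s) (suc w) (suc (scale k t b)) ⟩
      C * suc w                             ≡⟨ cong (_* suc w) H′-length ⟨
      length H′ * suc w                     ≤⟨ ∑-lower (suc w) H′ (proj₂ ∘ H′-∈) ⟩
      ∑ (G₂.degree V) H′                    ≡⟨ ∑-swap (λ x y → ind (y ~₂? x)) V H′ ⟨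
      ∑ (λ x → count (λ h → h ~₂? x) H′) V  ∎
      where
      reorder : ∀ a b c → a * (b * c) ≡ c * a * b
      reorder = solve-∀
    bc : Biclique _~₂_ H′ V (suc s) (leafCount k t b)
    bc = biclique-of-sum _~₂?_ C s (leafCount k t b) (UniqueP.take⁺ C (UniqueP.filter⁺ (λ x → w <? G₂.degree V x) uV)) uV
           (≤-reflexive H′-length) (≤-trans (s≤s z≤n) (m≤n+m (2 + k) (C + b + (2 + k)))) many
  ... | no ≰ = disjoint-of-light k ⌊ k /2⌋ t w (≤halves k) (halves≤ k) uV (≤-<-trans z≤n large) dense₂ w≤ w≥
                 (proj₁ lp) (λ f∈ → proj₁ (proj₂ lp) (∈-++⁺ʳ H f∈))
                 (proj₂ (proj₂ lp) (G₂.degree V) n w (G₂.degree≤length V)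
                    λ x∈ x∉ → ≮⇒≥ λ lt → x∉ (∈-++⁺ˡ (∈-filter⁺ (λ x → w <? G₂.degree V x) x∈ lt)))
    where
    n = length V
    C = hubs k t b
    w = n / suc (scale k t b)
    H = filter (λ x → w <? G₂.degree V x) V
    open ≤-Reasoning
    light< : lightBound k (C + b) < 2 * n
    light< = <-≤-trans (≤-<-trans (lightBound≤pathThreshold k t b) large) (m≤m+n n (n + 0))
    -- Adding `S` to the high-degree vertices makes the path start outside `S` as well.
    lp = G₁.lightPath k ⌊ k /2⌋ (C + b) (H ++ S) (≤halves k) (halves≤ k) uV
           (≤-trans (≤-reflexive (length-++ H)) (+-mono-≤ (<⇒≤ (≰⇒> ≰)) S≤b)) (dense⇒2k≤ k t (length V) (G₁.degreeSum V) dense₁) light<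
    w≤ : 2 * (2 + k + length S) * suc t * w ≤ n
    w≤ = begin
      2 * (2 + k + length S) * suc t * w ≤⟨ *-monoˡ-≤ w (*-monoˡ-≤ (suc t) (*-monoʳ-≤ 2 (+-monoʳ-≤ (2 + k) S≤b))) ⟩
      suc (scale k t b) * w              ≡⟨ *-comm (suc (scale k t b)) w ⟩
      w * suc (scale k t b)              ≤⟨ m/n*n≤m n (suc (scale k t b)) ⟩
      n ∎
    w≥ : length S + (2 + k) + (2 + k) ≤ w
    w≥ = begin
      length S + (2 + k) + (2 + k) ≤⟨ +-monoˡ-≤ (2 + k) (+-monoˡ-≤ (2 + k) S≤b) ⟩
      b + (2 + k) + (2 + k) ≡⟨ m*n/n≡m (b + (2 + k) + (2 + k)) (suc (scale k t b)) ⟨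
      (b + (2 + k) + (2 + k)) * suc (scale k t b) / suc (scale k t b)
        ≤⟨ /-monoˡ-≤ (suc (scale k t b)) (<⇒≤ (≤-<-trans (scale≤pathThreshold k t b) large)) ⟩
      w ∎

-- Coloured walks

∑-map : {A B : Set} (f : B → ℕ) (g : A → B) (xs : List A) → ∑ f (map g xs) ≡ ∑ (f ∘ g) xs
∑-map f g []       = refl
∑-map f g (x ∷ xs) = cong (f (g x) +_) (∑-map f g xs)

∑-tabulate : {A : Set} (f : A → ℕ) {m : ℕ} (g : Fin m → A) → ∑ f (tabulate g) ≡ ∑ (f ∘ g) (allFin m)
∑-tabulate f g = trans (cong (∑ f) (sym (map-tabulate id g))) (∑-map f g (allFin _))

lookup-injective : {A : Set} {xs : List A} → Unique xs → ∀ i j → lookup xs i ≡ lookup xs j → i ≡ j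
lookup-injective (x∉ ∷ u) zero    zero    _  = refl
lookup-injective (x∉ ∷ u) zero    (suc j) eq = contradiction eq (All.lookup x∉ (∈-lookup j))
lookup-injective (x∉ ∷ u) (suc i) zero    eq = contradiction (sym eq) (All.lookup x∉ (∈-lookup i))
lookup-injective (x∉ ∷ u) (suc i) (suc j) eq = cong suc (lookup-injective u i j eq)

multiplicity : Fin 3 → List (Fin 3) → ℕ
multiplicity col = count (Fin._≟ col)

multiplicity-replicate : ∀ col m a → multiplicity col (replicate m a) ≡ m * ind (a Fin.≟ col)
multiplicity-replicate col zero    a = refl
multiplicity-replicate col (suc m) a = cong (ind (a Fin.≟ col) +_) (multiplicity-replicate col m a)

length≡multiplicities : ∀ w → length w ≡ multiplicity zero w + multiplicity (suc zero) w + multiplicity (suc (suc zero)) w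
length≡multiplicities w = trans (classes₃ id w) (cong₂ _+_ (cong₂ _+_ (length-filter≡count _ w) (length-filter≡count _ w)) (length-filter≡count _ w))

-- Says that `a`, `b`, `d` are the three colours in some order, in the form that is multiplied by
-- the number of edges when the colours along a path are counted.
Spectrum : Fin 3 → Fin 3 → Fin 3 → Set
Spectrum a b d = ∀ col → ind (a Fin.≟ col) + ind (b Fin.≟ col) + ind (d Fin.≟ col) ≡ 1

spectrum-cases : ∀ {a b d} → Spectrum a b d → ∀ col → col ≡ a ⊎ col ≡ b ⊎ col ≡ d
spectrum-cases {a} {b} {d} sp col with a Fin.≟ col | b Fin.≟ col | d Fin.≟ col | sp col
... | yes p | _ | _ | _ = inj₁ (sym p)
... | no _ | yes p | _ | _ = inj₂ (inj₁ (sym p))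
... | no _ | no _ | yes p | _ = inj₂ (inj₂ (sym p))
... | no _ | no _ | no _ | ()

module Coloured {n : ℕ} (c : Colouring n) (c-sym : SymmetricColouring n c) where

  data ColourWalk : Fin n → Fin n → List (Fin n) → List (Fin 3) → Set where
    stop : ∀ {x} → ColourWalk x x [ x ] []
    step : ∀ {x y z a xs w} → c x y ≡ a → ColourWalk y z xs w → ColourWalk x z (x ∷ xs) (a ∷ w)

  Adj : Fin 3 → Fin n → Fin n → Set
  Adj a x y = x ≢ y × c x y ≡ a

  adj? : ∀ a x y → Dec (Adj a x y)
  adj? a x y = ¬? (x Fin.≟ y) ×-dec (c x y Fin.≟ a)

  adj-sym : ∀ {a x y} → Adj a x y → Adj a y x
  adj-sym (x≢y , e) = x≢y ∘ sym , trans (c-sym _ _) e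

  adj-irrefl : ∀ {a x} → ¬ Adj a x x
  adj-irrefl (x≢x , _) = x≢x refl

  monochromatic : ∀ {a x y xs m} → Walk (Adj a) x y xs → length xs ≡ suc m → ColourWalk x y xs (replicate m a)
  monochromatic {m = zero}  stop _ = stop
  monochromatic {m = suc m} stop ()
  monochromatic {m = zero}  (step _ stop) ()
  monochromatic {m = zero}  (step _ (step _ _)) ()
  monochromatic {m = suc m} (step (_ , e) w) l = step e (monochromatic w (suc-injective l))

  join : ∀ {x y z xs ys u v} → ColourWalk x y xs u → ColourWalk y z (y ∷ ys) v → ColourWalk x z (xs ++ ys) (u ++ v)
  join stop       q = q
  join (step e p) q = step e (join p q)

  colourWalk-length : ∀ {x y xs w} → ColourWalk x y xs w → length xs ≡ suc (length w)
  colourWalk-length stop = refl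
  colourWalk-length (step _ p) = cong suc (colourWalk-length p)

  count-lookup : ∀ {x y xs w} → ColourWalk x y (x ∷ xs) w → ∀ col →
    count (λ i → c (lookup (x ∷ xs) (inject₁ i)) (lookup xs i) Fin.≟ col) (allFin (length xs)) ≡ multiplicity col w
  count-lookup stop col = refl
  count-lookup (step refl stop) col = refl
  count-lookup (step {x = x} {y = x′} refl p@(step {xs = xs} _ _)) col = cong (ind (c x x′ Fin.≟ col) +_)
    (trans (∑-tabulate (λ i → ind (c (lookup (x ∷ x′ ∷ xs) (inject₁ i)) (lookup (x′ ∷ xs) i) Fin.≟ col)) {length xs} suc)
      (count-lookup p col))

  balanced : ∀ {x y xs w} k → ColourWalk x y xs w → Unique xs → (∀ col → multiplicity col w ≡ k) → HasBalancedP3k n k c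
  balanced {w = w} k p u mult = go p u (trans (colourWalk-length p) (cong suc length-w))
    where
    thrice : ∀ k → k + k + k ≡ 3 * k
    thrice = solve-∀
    length-w : length w ≡ 3 * k
    length-w = trans (length≡multiplicities w)
      (trans (cong₂ _+_ (cong₂ _+_ (mult zero) (mult (suc zero))) (mult (suc (suc zero)))) (thrice k))
    realise : ∀ {x y xs m} → ColourWalk x y (x ∷ xs) w → Unique (x ∷ xs) → length xs ≡ m →
      Σ (Fin (suc m) → Fin n) λ v → Injective _≡_ _≡_ v × (∀ col → pathColourCount n m c v col ≡ k)
    realise {x} {xs = xs} p u refl = lookup (x ∷ xs) , lookup-injective u _ _ ,
      λ col → trans (length-filter≡count (λ i → c (lookup (x ∷ xs) (inject₁ i)) (lookup xs i) Fin.≟ col) (allFin (length xs)))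
                (trans (count-lookup p col) (mult col))
    go : ∀ {x y xs} → ColourWalk x y xs w → Unique xs → length xs ≡ suc (3 * k) → HasBalancedP3k n k c
    go stop u l = realise stop u (suc-injective l)
    go p@(step _ _) u l = realise p u (suc-injective l)

  open Ramsey c public using (Clique; ramsey)

  -- The vertices of `R` lie strictly between `y` and `z`, whence one more edge than vertices. The
  -- edge from `y` to `z` itself is used only for empty `R`, and only then is its colour prescribed.
  bridge : ∀ {d y z w R zs v} → Clique d R → All (λ r → c y r ≡ d) R → All (λ r → c r z ≡ d) R →
    (R ≡ [] → c y z ≡ d) → ColourWalk z w zs v → ColourWalk y w (y ∷ R ++ zs) (replicate (suc (length R)) d ++ v)
  bridge [] [] [] direct q = step (direct refl) q
  bridge (cl ∷ cls) (yr ∷ yrs) (rz ∷ rzs) direct q =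
    step yr (bridge cls (All.map proj₂ cl) rzs (λ _ → rz) q)

  Disjoint : List (Fin n) → List (Fin n) → Set
  Disjoint xs ys = ∀ {x} → x ∈ xs → x ∉ ys

  assemble : ∀ {d x y z w xs zs u v R} k → ColourWalk x y xs u → ColourWalk z w zs v →
    Clique d R → All (λ r → c y r ≡ d) R → All (λ r → c r z ≡ d) R → (R ≡ [] → c y z ≡ d) →
    Unique xs → Unique zs → Disjoint xs R → Disjoint xs zs → Disjoint R zs →
    (∀ col → multiplicity col u + (suc (length R) * ind (d Fin.≟ col) + multiplicity col v) ≡ k) →
    HasBalancedP3k n k c
  assemble {d} {xs = xs} {zs} {u} {v} {R} k p q clique yR Rz direct uxs uzs xR xz Rz′ mult =
    balanced k (join p (bridge clique yR Rz direct q))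
      (UniqueP.++⁺ uxs (UniqueP.++⁺ (AllPairs.map proj₁ clique) uzs (λ (x∈ , x∈′) → Rz′ x∈ x∈′))
        λ (x∈ , x∈′) → avoid x∈ (∈-++⁻ R x∈′))
      (λ col → trans (∑-++ _ u _) (trans (cong (multiplicity col u +_) (trans (∑-++ _ (replicate (suc (length R)) d) v)
        (cong (_+ multiplicity col v) (multiplicity-replicate col (suc (length R)) d)))) (mult col)))
    where
    avoid : ∀ {x} → x ∈ xs → x ∈ R ⊎ x ∈ zs → ⊥
    avoid x∈ (inj₁ x∈R) = xR x∈ x∈R
    avoid x∈ (inj₂ x∈z) = xz x∈ x∈z

-- Extending a monochromatic clique to a balanced path

module AroundClique {n : ℕ} (c : Colouring n) (c-sym : SymmetricColouring n c) (k t : ℕ)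
                    {d : Fin 3} {K : List (Fin n)} (clique : Ramsey.Clique c d K) where

  open Coloured c c-sym
  open Deletion (Fin._≟_ {n})
  open Biclique
  private module CW = ColourWalk
  module Gr (e : Fin 3) = Graph Fin._≟_ (Adj e) (adj? e) adj-sym adj-irrefl
  open Graph.Path

  -- The number of vertices of a monochromatic path with suc k edges.  A fan must survive the deletion
  -- of such paths, whence its sizes 2L, 3L and 5L; K loses 2L vertices to two paths and 5L to each of two
  -- colours at each of two vertices, and still has L left: 23 = 2 + 4 · 5 + 1.
  L : ℕ
  L = 2 + k

  V : List (Fin n)
  V = allFin n

  K-unique : Unique K
  K-unique = AllPairs.map proj₁ clique

  clique-colour : ∀ {x y} → x ∈ K → y ∈ K → x ≢ y → c x y ≡ d
  clique-colour = go clique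
    where
    go : ∀ {K x y} → Clique d K → x ∈ K → y ∈ K → x ≢ y → c x y ≡ d
    go _        (here refl) (here refl) x≢y = contradiction refl x≢y
    go (h ∷ cl) (here refl) (there y∈)  x≢y = proj₂ (All.lookup h y∈)
    go (h ∷ cl) (there x∈)  (here refl) x≢y = trans (c-sym _ _) (proj₂ (All.lookup h x∈))
    go (h ∷ cl) (there x∈)  (there y∈)  x≢y = go cl x∈ y∈ x≢y

  nearby : Fin 3 → Fin n → ℕ
  nearby e v = count (λ q → c v q Fin.≟ e) K

  popular : Fin 3 → ℕ → List (Fin n)
  popular e θ = filter (λ v → θ ≤? nearby e v) V

  -- The requirement of `biclique-of-degrees` for `3 * L` leaves, plus `length K` so that the leaves
  -- can be taken outside `K`.
  popularBound : ℕ
  popularBound = 2 ^ length K * (3 * L) + length K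

  Rich : Fin 3 → ℕ → Set
  Rich e θ = popularBound ≤ length (popular e θ)

  unpopular : ∀ {e θ v} → v ∉ popular e θ → nearby e v ≤ θ
  unpopular {e} {θ} {v} v∉ = <⇒≤ (≰⇒> λ le → v∉ (∈-filter⁺ (λ v → θ ≤? nearby e v) (∈-allFin v) le))

  Fan : Fin 3 → ℕ → Set
  Fan e θ = Biclique (λ q v → c v q ≡ e) K (popular e θ ∖ K) θ (3 * L)

  fan : ∀ {e θ} → Rich e θ → Fan e θ
  fan {e} {θ} rich = biclique-of-degrees (λ q v → c v q Fin.≟ e) θ (3 * L) K-unique
    (∖-Unique K pop-unique)
    (λ v∈ → proj₂ (∈-filter⁻ (λ v → θ ≤? nearby e v) {xs = V} (proj₁ (∖-∈ (popular e θ) K v∈)))) (s≤s z≤n)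
    (+-cancelʳ-≤ (length K) _ _ (≤-trans rich (length-∖ K pop-unique)))
    where
    pop-unique = UniqueP.filter⁺ (λ v → θ ≤? nearby e v) (UniqueP.allFin⁺ n)

  -- A zigzag between the centres `hs` in `K` and the leaves not in `P`. Its leaves lie outside `K`,
  -- so it takes nothing from `K` but centres in `hs`.
  tail : ∀ {e θ} (F : Fan e θ) {hs} P m → Unique hs → (∀ {q} → q ∈ hs → q ∈ left F) → Disjoint hs P →
    m < length hs → length P + m ≤ 3 * L →
    Σ (Gr.Path e V m) λ p → first p ∈ hs × (∀ {x} → x ∈ vertices p → x ∉ P) ×
      (∀ {x} → x ∈ vertices p → x ∈ hs ⊎ x ∉ K)
  tail {e} {θ} F {hs} P m uhs hs⊆ hsP m< P≤ =
    Gr.weaken e (λ {x} _ → ∈-allFin x) (proj₁ zz) , proj₁ (proj₂ zz) , (λ x∈ → notP (where-∈ x∈)) , (λ x∈ → notK (where-∈ x∈))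
    where
    xs = right F ∖ P
    xs≥ : m ≤ length xs
    xs≥ = +-cancelˡ-≤ (length P) _ _ (≤-trans P≤ (≤-trans (≤-reflexive (sym (right-length F)))
            (≤-trans (length-∖ P (right-unique F)) (≤-reflexive (+-comm (length xs) (length P))))))
    outside : ∀ {x} → x ∈ xs → x ∉ K
    outside x∈ = proj₂ (∖-∈ (popular e θ) K (right⊆ F (proj₁ (∖-∈ (right F) P x∈))))
    zz = Gr.zigzag e m hs xs (≤-trans m< (m≤m+n _ _)) (≤-trans xs≥ (m≤m+n _ _)) uhs (∖-Unique P (right-unique F))
      (λ q∈ q∈xs → outside q∈xs (left⊆ F (hs⊆ q∈)))
      (λ q∈ x∈ → adj-sym ((λ { refl → outside x∈ (left⊆ F (hs⊆ q∈)) }) , complete F (hs⊆ q∈) (proj₁ (∖-∈ (right F) P x∈))))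
    where-∈ : ∀ {x} → x ∈ vertices (proj₁ zz) → x ∈ hs ⊎ x ∈ xs
    where-∈ x∈ = ∈-++⁻ hs (inside (proj₁ zz) x∈)
    notP : ∀ {x} → x ∈ hs ⊎ x ∈ xs → x ∉ P
    notP (inj₁ x∈) = hsP x∈
    notP (inj₂ x∈) = proj₂ (∖-∈ (right F) P x∈)
    notK : ∀ {x} → x ∈ hs ⊎ x ∈ xs → x ∈ hs ⊎ x ∉ K
    notK (inj₁ x∈) = inj₁ x∈
    notK (inj₂ x∈) = inj₂ (outside x∈)

  toEnd : ∀ {e U m} (p : Gr.Path e U m) → ColourWalk (last p) (first p) (reverse (vertices p)) (replicate m e)
  toEnd {e} p = monochromatic (walk (Gr.reversePath e p)) (len (Gr.reversePath e p))

  reverse-unique : ∀ {xs : List (Fin n)} → Unique xs → Unique (reverse xs)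
  reverse-unique {xs} = Unique-resp-↭ (↭-sym (↭-reverse xs))

  ∈-reverse⁻ : ∀ {x : Fin n} {xs} → x ∈ reverse xs → x ∈ xs
  ∈-reverse⁻ {xs = xs} = ∈-resp-↭ (↭-reverse xs)

  word : ∀ {a b} → Spectrum a b d → ∀ r → r ≡ k → ∀ col → multiplicity col (replicate (suc k) a) +
    (suc r * ind (d Fin.≟ col) + multiplicity col (replicate (suc k) b)) ≡ suc k
  word {a} {b} sp r refl col = trans (cong₂ (λ u v → u + (suc k * ind (d Fin.≟ col) + v))
      (multiplicity-replicate col (suc k) a) (multiplicity-replicate col (suc k) b))
    (trans (collect (suc k) (ind (a Fin.≟ col)) (ind (d Fin.≟ col)) (ind (b Fin.≟ col)))
      (trans (cong (suc k *_) (sp col)) (*-identityʳ (suc k))))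
    where
    collect : ∀ k a d b → k * a + (k * d + k * b) ≡ k * (a + b + d)
    collect = solve-∀

  -- For an a-path that enters `K` by an edge of colour `b`: this edge belongs to the first word,
  -- and the zigzag has one edge fewer.
  word′ : ∀ {a b} → Spectrum a b d → ∀ r → r ≡ k → ∀ col → multiplicity col (replicate (suc k) a ++ [ b ]) +
    (suc r * ind (d Fin.≟ col) + multiplicity col (replicate k b)) ≡ suc k
  word′ {a} {b} sp r refl col = trans (cong (_+ (suc k * ind (d Fin.≟ col) + multiplicity col (replicate k b)))
      (∑-++ (λ e → ind (e Fin.≟ col)) (replicate (suc k) a) [ b ]))
    (trans (regroup (multiplicity col (replicate (suc k) a)) (ind (b Fin.≟ col)) (suc k * ind (d Fin.≟ col)) (multiplicity col (replicate k b)))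
      (word {a} {b} sp k refl col))
    where
    regroup : ∀ u b d v → u + (b + 0) + (d + v) ≡ u + (d + (b + v))
    regroup = solve-∀

  fill : ∀ P → length P + k ≤ length K →
    Σ (List (Fin n)) λ R → length R ≡ k × Clique d R × (∀ {x} → x ∈ R → x ∈ K × x ∉ P)
  fill P le = take k (K ∖ P) , length-take≡ k (K ∖ P) enough ,
    AllPairsP.take⁺ k (AllPairsP.filter⁺ (λ x → ¬? (x ∈? P)) clique) , λ x∈ → ∖-∈ K P (∈-take k x∈)
    where
    enough : k ≤ length (K ∖ P)
    enough = +-cancelˡ-≤ (length P) _ _ (≤-trans le (≤-trans (length-∖ P K-unique) (≤-reflexive (+-comm _ (length P)))))

  through-K : ∀ {x y z w xs zs u v} → ColourWalk x y xs u → ColourWalk z w zs v → y ∈ K → z ∈ K →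
    y ∈ xs → z ∈ zs → Unique xs → Unique zs → Disjoint xs zs → length xs + length zs + k ≤ length K →
    (∀ r → r ≡ k → ∀ col → multiplicity col u + (suc r * ind (d Fin.≟ col) + multiplicity col v) ≡ suc k) →
    HasBalancedP3k n (suc k) c
  through-K {xs = xs} {zs} p q y∈K z∈K y∈ z∈ uxs uzs dis K≥ mult
    with fill (xs ++ zs) (subst (λ l → l + k ≤ length K) (sym (length-++ xs)) K≥)
  ... | R , R-length , R-clique , R∈ = assemble (suc k) p q R-clique
    (All.tabulate λ r∈ → clique-colour y∈K (proj₁ (R∈ r∈)) (λ { refl → proj₂ (R∈ r∈) (∈-++⁺ˡ y∈) }))
    (All.tabulate λ r∈ → clique-colour (proj₁ (R∈ r∈)) z∈K (λ { refl → proj₂ (R∈ r∈) (∈-++⁺ʳ xs z∈) }))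
    (λ _ → clique-colour y∈K z∈K λ { refl → dis y∈ z∈ })
    uxs uzs (λ x∈ x∈R → proj₂ (R∈ x∈R) (∈-++⁺ˡ x∈)) dis (λ x∈R x∈q → proj₂ (R∈ x∈R) (∈-++⁺ʳ xs x∈q))
    (mult (length R) R-length)

  L+L+k≤ : 23 * L ≤ length K → L + L + k ≤ length K
  L+L+k≤ K≥ = begin
    L + L + k        ≤⟨ +-monoʳ-≤ (L + L) (≤-trans (m≤n+m k 2) (m≤m+n L (20 * L))) ⟩
    L + L + 21 * L   ≡⟨ +-assoc L L (21 * L) ⟩
    23 * L           ≤⟨ K≥ ⟩
    length K         ∎
    where open ≤-Reasoning

  L+suc-k≤ : L + suc k ≤ 3 * L
  L+suc-k≤ = +-monoʳ-≤ L (≤-trans (n≤1+n (suc k)) (m≤m+n L _))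

  -- The first path may cover `L` of the `2 * L` centres of the second fan; the other `L` still
  -- carry the second zigzag.
  both-rich : ∀ {a b} → Spectrum a b d → 23 * L ≤ length K → Rich a (2 * L) → Rich b (2 * L) → HasBalancedP3k n (suc k) c
  both-rich {a} {b} sp K≥ richA richB = first-half (fan richA)
    where
    open ≤-Reasoning
    second-half : (p : Gr.Path a V (suc k)) → first p ∈ K → Fan b (2 * L) → HasBalancedP3k n (suc k) c
    second-half p p₀∈K B = conclude (tail B P (suc k) (∖-Unique P (left-unique B))
        (proj₁ ∘ ∖-∈ (left B) P) (proj₂ ∘ ∖-∈ (left B) P) hs≥ (subst (λ l → l + suc k ≤ 3 * L) (sym (len p)) L+suc-k≤))
      where
      P = vertices p
      hs = left B ∖ P
      hs≥ : L ≤ length hs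
      hs≥ = +-cancelʳ-≤ L _ _ (begin
        L + L                ≡⟨ cong (L +_) (+-identityʳ L) ⟨
        2 * L                ≡⟨ left-length B ⟨
        length (left B)      ≤⟨ length-∖ P (left-unique B) ⟩
        length hs + length P ≡⟨ cong (length hs +_) (len p) ⟩
        length hs + L        ∎)
      conclude : (Σ (Gr.Path b V (suc k)) λ q → first q ∈ hs × (∀ {x} → x ∈ vertices q → x ∉ P) ×
        (∀ {x} → x ∈ vertices q → x ∈ hs ⊎ x ∉ K)) → HasBalancedP3k n (suc k) c
      conclude (q , q₀∈ , q∉P , _) = through-K (toEnd p) (monochromatic (walk q) (len q)) p₀∈K
        (left⊆ B (proj₁ (∖-∈ (left B) P q₀∈)))
        (∈-resp-↭ (↭-sym (↭-reverse P)) (Gr.walk-head a (walk p))) (Gr.walk-head b (walk q))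
        (reverse-unique (unique p)) (unique q) (λ x∈ x∈q → q∉P x∈q (∈-reverse⁻ x∈))
        (subst₂ (λ l m → l + m + k ≤ length K) (sym (trans (length-reverse P) (len p))) (sym (len q)) (L+L+k≤ K≥))
        (word {a} {b} sp)
    first-half : Fan a (2 * L) → HasBalancedP3k n (suc k) c
    first-half A with tail A [] (suc k) (left-unique A) id (λ _ ()) (subst (suc k <_) (sym (left-length A)) (m≤m+n L _))
                        (≤-trans (n≤1+n (suc k)) (m≤m+n L _))
    ... | p , p₀∈ , _ = second-half p (left⊆ A p₀∈) (fan richB)

  colour-classes : ∀ {a b} → Spectrum a b d → ∀ y {X} → Unique X → (∀ {x} → x ∈ X → x ∈ K) →
    length X ≤ length (filter (λ r → c y r Fin.≟ d) X) + (nearby a y + count (λ r → c y r Fin.≟ b) X)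
  colour-classes {a} {b} sp y {X} uX X⊆ = begin
    length X                   ≡⟨ length≡∑ X ⟩
    ∑ (λ _ → 1) X              ≤⟨ ∑-mono X (λ {r} _ → pointwise r) ⟩
    ∑ (λ r → is d r + (is a r + is b r)) X ≡⟨ trans (∑-+ (is d) _ X) (cong (∑ (is d) X +_) (∑-+ (is a) (is b) X)) ⟩
    ∑ (is d) X + (∑ (is a) X + ∑ (is b) X)
      ≤⟨ +-mono-≤ (≤-reflexive (sym (length-filter≡count (λ r → c y r Fin.≟ d) X)))
                  (+-monoˡ-≤ (∑ (is b) X) (Unique⇒∑≤ K uX λ x∈ _ → X⊆ x∈)) ⟩
    length (filter (λ r → c y r Fin.≟ d) X) + (nearby a y + ∑ (is b) X) ∎
    where
    open ≤-Reasoning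
    is : Fin 3 → Fin n → ℕ
    is e r = ind (c y r Fin.≟ e)
    pointwise : ∀ r → 1 ≤ is d r + (is a r + is b r)
    pointwise r = begin
      1 ≡⟨ sp (c y r) ⟨
      ind (a Fin.≟ c y r) + ind (b Fin.≟ c y r) + ind (d Fin.≟ c y r)
        ≤⟨ +-mono-≤ (+-mono-≤ (ind-mono (a Fin.≟ c y r) (c y r Fin.≟ a) sym) (ind-mono (b Fin.≟ c y r) (c y r Fin.≟ b) sym))
                    (ind-mono (d Fin.≟ c y r) (c y r Fin.≟ d) sym) ⟩
      is a r + is b r + is d r ≡⟨ +-comm (is a r + is b r) (is d r) ⟩
      is d r + (is a r + is b r) ∎

  subclique : ∀ X → Unique X → (∀ {x} → x ∈ X → x ∈ K) → Clique d X
  subclique [] _ _ = []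
  subclique (x ∷ X) (x∉ ∷ u) X⊆ =
    All.tabulate (λ z∈ → All.lookup x∉ z∈ , clique-colour (X⊆ (here refl)) (X⊆ (there z∈)) (All.lookup x∉ z∈))
    ∷ subclique X u (X⊆ ∘ there)

  -- At least `4 * L` of the `5 * L` centres lie off `p`. If the start of `p` sends an edge of
  -- colour `b` to one of them, that edge leads into `K` and counts as the first of colour `b`.
  -- Otherwise at most `2 * L` of its edges to them have colour `a`, so `2 * L` have colour `d`: `k`
  -- of these centres form the bridge, and at least `L` are left to carry the zigzag.
  one-rich : ∀ {a b} → Spectrum a b d → 23 * L ≤ length K → Rich b (5 * L) →
    (p : Gr.Path a V (suc k)) → first p ∉ popular a (2 * L) → HasBalancedP3k n (suc k) c
  one-rich {a} {b} sp K≥ rich p y∉ = with-fan (fan rich)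
    where
    open ≤-Reasoning
    P = vertices p
    y = first p
    with-fan : Fan b (5 * L) → HasBalancedP3k n (suc k) c
    with-fan F = by-colour (Any.any? (λ q → c y q Fin.≟ b) hs)
      where
      hs = left F ∖ P
      hs-unique = ∖-Unique P (left-unique F)
      hs-∈ : ∀ {q} → q ∈ hs → q ∈ left F × q ∉ P
      hs-∈ = ∖-∈ (left F) P
      hs⊆K : ∀ {q} → q ∈ hs → q ∈ K
      hs⊆K = left⊆ F ∘ proj₁ ∘ hs-∈
      hs≥ : 4 * L ≤ length hs
      hs≥ = +-cancelˡ-≤ L _ _ (begin
        5 * L                ≡⟨ left-length F ⟨
        length (left F)      ≤⟨ length-∖ P (left-unique F) ⟩
        length hs + length P ≡⟨ cong (length hs +_) (len p) ⟩
        length hs + L        ≡⟨ +-comm (length hs) L ⟩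
        L + length hs        ∎)

      step-b : ∀ {q} → q ∈ hs → c y q ≡ b → HasBalancedP3k n (suc k) c
      step-b {q} q∈ yq = conclude (tail F (q ∷ P) k (∖-Unique [ q ] hs-unique)
          (proj₁ ∘ hs-∈ ∘ proj₁ ∘ ∖-∈ hs [ q ]) hs′∉ hs′≥ small)
        where
        hs′ = hs ∖ [ q ]
        hs′≥ : suc k ≤ length hs′
        hs′≥ = +-cancelʳ-≤ 1 _ _ (begin
          suc k + 1      ≡⟨ +-comm (suc k) 1 ⟩
          L              ≤⟨ m≤m+n L (3 * L) ⟩
          4 * L          ≤⟨ hs≥ ⟩
          length hs      ≤⟨ length-∖ [ q ] hs-unique ⟩
          length hs′ + 1 ∎)
        hs′∉ : Disjoint hs′ (q ∷ P)
        hs′∉ x∈ (here eq)   = proj₂ (∖-∈ hs [ q ] x∈) (here eq)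
        hs′∉ x∈ (there x∈P) = proj₂ (hs-∈ (proj₁ (∖-∈ hs [ q ] x∈))) x∈P
        small : length (q ∷ P) + k ≤ 3 * L
        small = begin
          suc (length P) + k ≡⟨ +-suc (length P) k ⟨
          length P + suc k   ≡⟨ cong (_+ suc k) (len p) ⟩
          L + suc k          ≤⟨ L+suc-k≤ ⟩
          3 * L              ∎
        front : ∀ {x} → x ∈ reverse P ++ [ q ] → x ∈ q ∷ P
        front x∈ with ∈-++⁻ (reverse P) x∈
        ... | inj₁ x∈P = there (∈-reverse⁻ x∈P)
        ... | inj₂ (here eq) = here eq
        conclude : (Σ (Gr.Path b V k) λ s → first s ∈ hs′ × (∀ {x} → x ∈ vertices s → x ∉ q ∷ P) ×
          (∀ {x} → x ∈ vertices s → x ∈ hs′ ⊎ x ∉ K)) → HasBalancedP3k n (suc k) c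
        conclude (s , s₀∈ , s∉ , _) = through-K (join (toEnd p) (CW.step yq CW.stop)) (monochromatic (walk s) (len s))
          (hs⊆K q∈) (hs⊆K (proj₁ (∖-∈ hs [ q ] s₀∈))) (∈-++⁺ʳ (reverse P) (here refl)) (Gr.walk-head b (walk s))
          (UniqueP.++⁺ (reverse-unique (unique p)) ([] ∷ []) λ { (x∈ , here refl) → proj₂ (hs-∈ q∈) (∈-reverse⁻ x∈) })
          (unique s) (λ x∈ x∈s → s∉ x∈s (front x∈))
          (begin
            length (reverse P ++ [ q ]) + length (vertices s) + k
              ≡⟨ cong₂ (λ l m → l + m + k) (trans (length-++ (reverse P)) (cong (_+ 1) (trans (length-reverse P) (len p)))) (len s) ⟩
            L + 1 + suc k + k  ≡⟨ cong (_+ k) (+-assoc L 1 (suc k)) ⟩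
            L + L + k          ≤⟨ L+L+k≤ K≥ ⟩
            length K           ∎)
          (word′ {a} {b} sp)

      all-d : (∀ {q} → q ∈ hs → c y q ≢ b) → HasBalancedP3k n (suc k) c
      all-d none = conclude (tail F P (suc k) (∖-Unique R good-unique) (proj₁ ∘ good-∈ ∘ proj₁ ∘ ∖-∈ good R)
            (proj₂ ∘ good-∈ ∘ proj₁ ∘ ∖-∈ good R) rest≥ (subst (λ l → l + suc k ≤ 3 * L) (sym (len p)) L+suc-k≤))
        where
        good? : Decidable (λ q → c y q ≡ d)
        good? q = c y q Fin.≟ d
        good = filter good? hs
        good-unique = UniqueP.filter⁺ good? hs-unique
        good-∈ : ∀ {q} → q ∈ good → q ∈ left F × q ∉ P
        good-∈ = hs-∈ ∘ proj₁ ∘ ∈-filter⁻ good? {xs = hs}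
        good⊆K : ∀ {q} → q ∈ good → q ∈ K
        good⊆K = left⊆ F ∘ proj₁ ∘ good-∈
        y-good : ∀ {q} → q ∈ good → c y q ≡ d
        y-good = proj₂ ∘ ∈-filter⁻ good? {xs = hs}
        no-b : count (λ r → c y r Fin.≟ b) hs ≡ 0
        no-b = trans (∑-cong hs λ {r} r∈ → ind-no (c y r Fin.≟ b) (none r∈)) (trans (∑-const 0 hs) (*-zeroʳ (length hs)))
        good≥ : L + L ≤ length good
        good≥ = +-cancelʳ-≤ (2 * L) _ _ (begin
          L + L + 2 * L   ≡⟨ +-assoc L L (2 * L) ⟩
          4 * L           ≤⟨ hs≥ ⟩
          length hs       ≤⟨ colour-classes {a} {b} sp y hs-unique hs⊆K ⟩
          length good + (nearby a y + count (λ r → c y r Fin.≟ b) hs)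
            ≡⟨ cong (length good +_) (trans (cong (nearby a y +_) no-b) (+-identityʳ _)) ⟩
          length good + nearby a y ≤⟨ +-monoʳ-≤ (length good) (unpopular y∉) ⟩
          length good + 2 * L ∎)
        R = take k good
        rest≥ : L ≤ length (good ∖ R)
        rest≥ = +-cancelʳ-≤ L _ _ (begin
          L + L                        ≤⟨ good≥ ⟩
          length good                  ≤⟨ length-∖ R good-unique ⟩
          length (good ∖ R) + length R
            ≤⟨ +-monoʳ-≤ (length (good ∖ R)) (≤-trans (≤-reflexive (length-take k good)) (≤-trans (m⊓n≤m k _) (m≤n+m k 2))) ⟩
          length (good ∖ R) + L        ∎)
        R-length : length R ≡ k
        R-length = length-take≡ k good (≤-trans (≤-trans (m≤n+m k 2) (m≤m+n L L)) good≥)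
        conclude : (Σ (Gr.Path b V (suc k)) λ s → first s ∈ good ∖ R × (∀ {x} → x ∈ vertices s → x ∉ P) ×
          (∀ {x} → x ∈ vertices s → x ∈ good ∖ R ⊎ x ∉ K)) → HasBalancedP3k n (suc k) c
        conclude (s , s₀∈ , s∉ , s-where) = assemble (suc k) (toEnd p) (monochromatic (walk s) (len s))
          (subclique R (UniqueP.take⁺ k good-unique) (good⊆K ∘ ∈-take k))
          (All.tabulate λ r∈ → y-good (∈-take k r∈))
          (All.tabulate λ r∈ → clique-colour (good⊆K (∈-take k r∈)) (good⊆K (proj₁ (∖-∈ good R s₀∈)))
            (λ { refl → proj₂ (∖-∈ good R s₀∈) r∈ }))
          (λ _ → y-good (proj₁ (∖-∈ good R s₀∈)))
          (reverse-unique (unique p)) (unique s)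
          (λ x∈ x∈R → proj₂ (good-∈ (∈-take k x∈R)) (∈-reverse⁻ x∈))
          (λ x∈ x∈s → s∉ x∈s (∈-reverse⁻ x∈))
          (λ x∈R x∈s → apart x∈R (s-where x∈s))
          (word {a} {b} sp (length R) R-length)
          where
          apart : ∀ {x} → x ∈ R → x ∈ good ∖ R ⊎ x ∉ K → ⊥
          apart x∈R (inj₁ x∈) = proj₂ (∖-∈ good R x∈) x∈R
          apart x∈R (inj₂ x∉) = x∉ (good⊆K (∈-take k x∈R))

      by-colour : Dec (Any.Any (λ q → c y q ≡ b) hs) → HasBalancedP3k n (suc k) c
      by-colour (yes any) = let _ , q∈ , yq = find any in step-b q∈ yq
      by-colour (no none) = all-d λ q∈ yq → none (lose q∈ yq)

  d-neighbours : ∀ {a b} → Spectrum a b d → ∀ θ y {X} → y ∉ popular a θ → y ∉ popular b θ → Unique X →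
    (∀ {x} → x ∈ X → x ∈ K) → length X ≤ length (filter (λ r → c y r Fin.≟ d) X) + (θ + θ)
  d-neighbours {a} {b} sp θ y {X} y∉a y∉b uX X⊆ = ≤-trans (colour-classes {a} {b} sp y uX X⊆)
    (+-monoʳ-≤ (length (filter (λ r → c y r Fin.≟ d) X))
      (+-mono-≤ (unpopular y∉a) (≤-trans (Unique⇒∑≤ K uX (λ x∈ _ → X⊆ x∈)) (unpopular y∉b))))

  word-abd : ∀ {a b} → Spectrum a b d → k ≡ 0 → ∀ col → multiplicity col (replicate (suc k) a ++ b ∷ d ∷ []) ≡ suc k
  word-abd {a} {b} sp k≡0 col rewrite k≡0 = trans (sum (ind (a Fin.≟ col)) (ind (b Fin.≟ col)) (ind (d Fin.≟ col))) (sp col)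
    where
    sum : ∀ a b d → a + (b + (d + 0)) ≡ a + b + d
    sum = solve-∀

  word-dab : ∀ {a b} → Spectrum a b d → k ≡ 0 → ∀ col → multiplicity col (d ∷ a ∷ replicate (suc k) b) ≡ suc k
  word-dab {a} {b} sp k≡0 col rewrite k≡0 = trans (sum (ind (a Fin.≟ col)) (ind (b Fin.≟ col)) (ind (d Fin.≟ col))) (sp col)
    where
    sum : ∀ a b d → d + (a + (b + 0)) ≡ a + b + d
    sum = solve-∀

  -- Each start has at most `5 * L` neighbours in `K` in either of the colours `a` and `b`. So at
  -- least `L` vertices of `K` off both paths are joined to both starts in colour `d`, and `k` of
  -- them form the bridge.
  neither-rich : ∀ {a b} → Spectrum a b d → 23 * L ≤ length K →
    (p : Gr.Path a V (suc k)) (q : Gr.Path b V (suc k)) → Disjoint (vertices p) (vertices q) →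
    first p ∉ popular a (5 * L) → first p ∉ popular b (5 * L) →
    first q ∉ popular a (5 * L) → first q ∉ popular b (5 * L) → HasBalancedP3k n (suc k) c
  neither-rich {a} {b} sp K≥ p q dis y∉a y∉b z∉a z∉b = link (c y z Fin.≟ d) (k ≟ 0)
    where
    open ≤-Reasoning
    y = first p
    z = first q
    P = vertices p
    Q = vertices q
    y∈ = Gr.walk-head a (walk p)
    z∈ = Gr.walk-head b (walk q)
    X₀ = K ∖ (P ++ Q)
    X₁ = filter (λ r → c y r Fin.≟ d) X₀
    X₂ = filter (λ r → c z r Fin.≟ d) X₁
    X₁-unique = UniqueP.filter⁺ (λ r → c y r Fin.≟ d) (∖-Unique (P ++ Q) K-unique)
    X₁-∈ : ∀ {r} → r ∈ X₁ → r ∈ X₀ × c y r ≡ d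
    X₁-∈ = ∈-filter⁻ (λ r → c y r Fin.≟ d) {xs = X₀}
    X₂-∈ : ∀ {r} → r ∈ X₂ → r ∈ X₁ × c z r ≡ d
    X₂-∈ = ∈-filter⁻ (λ r → c z r Fin.≟ d) {xs = X₁}
    X₂-yd : ∀ {r} → r ∈ X₂ → c y r ≡ d
    X₂-yd = proj₂ ∘ X₁-∈ ∘ proj₁ ∘ X₂-∈
    X₂-K : ∀ {r} → r ∈ X₂ → r ∈ K × r ∉ P ++ Q
    X₂-K = ∖-∈ K (P ++ Q) ∘ proj₁ ∘ X₁-∈ ∘ proj₁ ∘ X₂-∈
    X₂≥ : L ≤ length X₂
    X₂≥ = +-cancelʳ-≤ (22 * L) _ _ (begin
      23 * L                               ≤⟨ K≥ ⟩
      length K                             ≤⟨ length-∖ (P ++ Q) K-unique ⟩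
      length X₀ + length (P ++ Q)          ≡⟨ cong (length X₀ +_) (trans (length-++ P) (cong₂ _+_ (len p) (len q))) ⟩
      length X₀ + (L + L)                  ≤⟨ +-monoˡ-≤ (L + L) (d-neighbours {a} {b} sp (5 * L) y y∉a y∉b (∖-Unique (P ++ Q) K-unique) (proj₁ ∘ ∖-∈ K (P ++ Q))) ⟩
      length X₁ + (5 * L + 5 * L) + (L + L)
        ≤⟨ +-monoˡ-≤ (L + L) (+-monoˡ-≤ (5 * L + 5 * L) (d-neighbours {a} {b} sp (5 * L) z z∉a z∉b X₁-unique (proj₁ ∘ ∖-∈ K (P ++ Q) ∘ proj₁ ∘ X₁-∈))) ⟩
      length X₂ + (5 * L + 5 * L) + (5 * L + 5 * L) + (L + L) ≡⟨ total (length X₂) L ⟩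
      length X₂ + 22 * L                   ∎)
      where
      total : ∀ x l → x + (5 * l + 5 * l) + (5 * l + 5 * l) + (l + l) ≡ x + 22 * l
      total = solve-∀
    R = take k X₂
    R-length : length R ≡ k
    R-length = length-take≡ k X₂ (≤-trans (m≤n+m k 2) X₂≥)

    bridged : (R ≡ [] → c y z ≡ d) → HasBalancedP3k n (suc k) c
    bridged direct = assemble (suc k) (toEnd p) (monochromatic (walk q) (len q))
      (subclique R (UniqueP.take⁺ k (UniqueP.filter⁺ (λ r → c z r Fin.≟ d) X₁-unique)) (proj₁ ∘ X₂-K ∘ ∈-take k))
      (All.tabulate (X₂-yd ∘ ∈-take k)) (All.tabulate λ r∈ → trans (c-sym _ _) (proj₂ (X₂-∈ (∈-take k r∈)))) direct
      (reverse-unique (unique p)) (unique q)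
      (λ x∈ x∈R → proj₂ (X₂-K (∈-take k x∈R)) (∈-++⁺ˡ (∈-reverse⁻ {xs = P} x∈)))
      (λ x∈ → dis (∈-reverse⁻ x∈))
      (λ x∈R x∈q → proj₂ (X₂-K (∈-take k x∈R)) (∈-++⁺ʳ P x∈q))
      (word {a} {b} sp (length R) R-length)

    -- The bridge through K needs two edges of colour d, so k + 1 = 1 is treated apart: a rainbow
    -- path of length 3 uses the edge yz itself.
    rainbow : k ≡ 0 → (c y z ≡ a ⊎ c y z ≡ b) → ∀ {r} → r ∈ X₂ → HasBalancedP3k n (suc k) c
    rainbow k≡0 (inj₁ yz≡a) {r} r∈ = balanced (suc k)
      (CW.step (trans (c-sym _ _) (X₂-yd r∈)) (CW.step yz≡a (monochromatic (walk q) (len q))))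
      (((λ { refl → proj₂ (X₂-K r∈) (∈-++⁺ˡ y∈) }) ∷ All.tabulate (λ x∈ → λ { refl → proj₂ (X₂-K r∈) (∈-++⁺ʳ P x∈) }))
        ∷ All.tabulate (λ x∈ → λ { refl → dis y∈ x∈ }) ∷ unique q)
      (word-dab {a} {b} sp k≡0)
    rainbow k≡0 (inj₂ yz≡b) {r} r∈ = balanced (suc k)
      (join (toEnd p) (CW.step yz≡b (CW.step (proj₂ (X₂-∈ r∈)) CW.stop)))
      (UniqueP.++⁺ (reverse-unique (unique p))
        (((λ { refl → proj₂ (X₂-K r∈) (∈-++⁺ʳ P z∈) }) ∷ []) ∷ [] ∷ [])
        (λ { (x∈ , here refl) → dis (∈-reverse⁻ x∈) z∈
           ; (x∈ , there (here refl)) → proj₂ (X₂-K r∈) (∈-++⁺ˡ (∈-reverse⁻ {xs = P} x∈)) }))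
      (word-abd {a} {b} sp k≡0)

    link : Dec (c y z ≡ d) → Dec (k ≡ 0) → HasBalancedP3k n (suc k) c
    link (yes yz) _ = bridged λ _ → yz
    link (no _) (no k≢0) = bridged λ R≡[] → contradiction (trans (sym R-length) (cong length R≡[])) k≢0
    link (no yz≢d) (yes k≡0) = rainbow k≡0 ab (proj₂ (nonempty⇒∃∈ X₂ (≤-trans (s≤s z≤n) X₂≥)))
      where
      ab : c y z ≡ a ⊎ c y z ≡ b
      ab with spectrum-cases {a} {b} {d} sp (c y z)
      ... | inj₁ e = inj₁ e
      ... | inj₂ (inj₁ e) = inj₂ e
      ... | inj₂ (inj₂ e) = contradiction e yz≢d

  rich-mono : ∀ {e θ θ′} → θ ≤ θ′ → Rich e θ′ → Rich e θ
  rich-mono {e} {θ} {θ′} θ≤ rich = ≤-trans rich (subst₂ _≤_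
    (sym (length-filter≡count (λ v → θ′ ≤? nearby e v) V)) (sym (length-filter≡count (λ v → θ ≤? nearby e v) V))
    (∑-mono V λ {v} _ → ind-mono (θ′ ≤? nearby e v) (θ ≤? nearby e v) (≤-trans θ≤)))

  Dense : Fin 3 → Set
  Dense e = 2 * (suc k * suc t + 1) * length V ≤ suc t * Gr.degreeSum e V

  -- The cases are exhaustive because richness passes to smaller thresholds: if one colour fails at
  -- `2 * L`, it fails at `5 * L` too, and the other colour is either rich at `5 * L` or fails there
  -- as well. The exceptional set consists of at most two popular sets, whence `β + β`.
  from-clique : ∀ {a b} β → Spectrum a b d → 23 * L ≤ length K → popularBound ≤ β → pathThreshold k t (β + β) < length V →
    Dense a → Dense b → HasBalancedP3k n (suc k) c
  from-clique {a} {b} β sp K≥ β≥ large denseA denseB =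
    decide (popularBound ≤? length (popular a (2 * L))) (popularBound ≤? length (popular b (2 * L)))
           (popularBound ≤? length (popular a (5 * L))) (popularBound ≤? length (popular b (5 * L)))
    where
    open DisjointPaths Fin._≟_ (Adj a) (adj? a) adj-sym adj-irrefl (Adj b) (adj? b) adj-sym adj-irrefl
    pair : ∀ S → length S ≤ β + β → DisjointPair V S (suc k)
    pair S S≤ = disjointPaths k t (β + β) S S≤ (UniqueP.allFin⁺ n) large denseA denseB
    2≤5 : 2 * L ≤ 5 * L
    2≤5 = *-monoˡ-≤ L {2} {5} (s≤s (s≤s z≤n))
    swap : Spectrum b a d
    swap col = trans (cong (_+ ind (d Fin.≟ col)) (+-comm (ind (b Fin.≟ col)) (ind (a Fin.≟ col)))) (sp col)
    few : ∀ {e θ} → ¬ Rich e θ → length (popular e θ) ≤ β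
    few ¬rich = ≤-trans (<⇒≤ (≰⇒> ¬rich)) β≥
    small : ∀ {e θ} → ¬ Rich e θ → length (popular e θ) ≤ β + β
    small ¬rich = ≤-trans (few ¬rich) (m≤m+n β β)
    decide : Dec (Rich a (2 * L)) → Dec (Rich b (2 * L)) → Dec (Rich a (5 * L)) → Dec (Rich b (5 * L)) → HasBalancedP3k n (suc k) c
    decide (yes a₂) (yes b₂) _ _ = both-rich {a} {b} sp K≥ a₂ b₂
    decide (no ¬a₂) _ _ (yes b₅) with pair (popular a (2 * L)) (small ¬a₂)
    ... | p , _ , p∉ , _ = one-rich {a} {b} sp K≥ b₅ p p∉
    decide _ (no ¬b₂) (yes a₅) _ with pair (popular b (2 * L)) (small ¬b₂)
    ... | _ , q , _ , q∉ , _ = one-rich {b} {a} swap K≥ a₅ q q∉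
    decide (no ¬a₂) _ (yes a₅) _ = contradiction (rich-mono 2≤5 a₅) ¬a₂
    decide _ (no ¬b₂) _ (yes b₅) = contradiction (rich-mono 2≤5 b₅) ¬b₂
    decide _ _ (no ¬a₅) (no ¬b₅)
      with pair (popular a (5 * L) ++ popular b (5 * L))
             (≤-trans (≤-reflexive (length-++ (popular a (5 * L)))) (+-mono-≤ (few ¬a₅) (few ¬b₅)))
    ... | p , q , p∉ , q∉ , dis = neither-rich {a} {b} sp K≥ p q dis
      (p∉ ∘ ∈-++⁺ˡ) (p∉ ∘ ∈-++⁺ʳ (popular a (5 * L))) (q∉ ∘ ∈-++⁺ˡ) (q∉ ∘ ∈-++⁺ʳ (popular a (5 * L)))

-- From edge counts to degree sums, and the upper bound

∑-concatMap : {A B : Set} (f : B → ℕ) (g : A → List B) (xs : List A) → ∑ f (concatMap g xs) ≡ ∑ (λ x → ∑ f (g x)) xs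
∑-concatMap f g []       = refl
∑-concatMap f g (x ∷ xs) = trans (∑-++ f (g x) (concatMap g xs)) (cong (∑ f (g x) +_) (∑-concatMap f g xs))

module _ {n : ℕ} (c : Colouring n) where

  ordered? : ∀ col (x y : Fin n) → Dec (toℕ x < toℕ y × c x y ≡ col)
  ordered? col x y = (toℕ x <? toℕ y) ×-dec (c x y Fin.≟ col)

  colourCount≡∑ : ∀ col → colourCount n c col ≡ ∑ (λ x → count (ordered? col x) (allFin n)) (allFin n)
  colourCount≡∑ col = trans (length-filter≡count (λ p → ordered? col (proj₁ p) (proj₂ p)) (allPairs n))
    (trans (∑-concatMap _ (λ i → map (i ,_) (allFin n)) (allFin n))
      (∑-cong (allFin n) λ {x} _ → ∑-map _ (x ,_) (allFin n)))

  module _ (c-sym : SymmetricColouring n c) where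

    open Coloured c c-sym

    handshake : ∀ a → 2 * colourCount n c a ≤ Graph.degreeSum Fin._≟_ (Adj a) (adj? a) adj-sym adj-irrefl (allFin n)
    handshake a = begin
      2 * colourCount n c a ≡⟨ cong (colourCount n c a +_) (+-identityʳ _) ⟩
      colourCount n c a + colourCount n c a ≡⟨ cong₂ _+_ (colourCount≡∑ a) (trans (colourCount≡∑ a) (∑-swap (λ x y → ind (ordered? a x y)) U U)) ⟩
      ∑ (λ x → count (ordered? a x) U) U + ∑ (λ x → ∑ (λ y → ind (ordered? a y x)) U) U ≡⟨ ∑-+ _ _ U ⟨
      ∑ (λ x → count (ordered? a x) U + ∑ (λ y → ind (ordered? a y x)) U) U
        ≤⟨ ∑-mono U (λ {x} _ → ≤-trans (≤-reflexive (sym (∑-+ (λ y → ind (ordered? a x y)) (λ y → ind (ordered? a y x)) U))) (∑-mono U λ {y} _ → pointwise x y)) ⟩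
      ∑ (λ x → count (adj? a x) U) U ∎
      where
      open ≤-Reasoning
      U = allFin n
      pointwise : ∀ x y → ind (ordered? a x y) + ind (ordered? a y x) ≤ ind (adj? a x y)
      pointwise x y = exclusive (ordered? a x y) (ordered? a y x) (adj? a x y)
        (λ (x<y , e) → (λ { refl → <-irrefl refl x<y }) , e)
        (λ (y<x , e) → (λ { refl → <-irrefl refl y<x }) , trans (c-sym x y) e)
        (λ (x<y , _) (y<x , _) → <-asym x<y y<x)
        where
        exclusive : {P Q R : Set} (p : Dec P) (q : Dec Q) (r : Dec R) → (P → R) → (Q → R) → (P → Q → ⊥) →
          ind p + ind q ≤ ind r
        exclusive (yes p) q r P⇒R _ P⇒¬Q rewrite ind-no q (P⇒¬Q p) = ≤-reflexive (sym (ind-yes r (P⇒R p)))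
        exclusive (no _) q r _ Q⇒R _ = ind-mono q r Q⇒R

complement : ∀ d → Σ (Fin 3 × Fin 3) λ (a , b) → Spectrum a b d
complement zero             = (suc zero , suc (suc zero)) , λ { zero → refl ; (suc zero) → refl ; (suc (suc zero)) → refl }
complement (suc zero)       = (zero , suc (suc zero))     , λ { zero → refl ; (suc zero) → refl ; (suc (suc zero)) → refl }
complement (suc (suc zero)) = (zero , suc zero)           , λ { zero → refl ; (suc zero) → refl ; (suc (suc zero)) → refl }

-- The strict hypothesis makes up for the rounding in `n / suc t`: it adds 1 to the quotient, and
-- `suc (n / suc t) * suc t` exceeds `n`.
count⇒dense : ∀ k t n m → suc k * n + n / suc t < m → 2 * (suc k * suc t + 1) * n ≤ suc t * (2 * m)
count⇒dense k t n m lt = begin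
  2 * (suc k * suc t + 1) * n                        ≡⟨ expand (suc k) (suc t) n ⟩
  2 * (suc t * (suc k * n) + n)                      ≤⟨ *-monoʳ-≤ 2 (+-monoʳ-≤ (suc t * (suc k * n)) (<⇒≤ (m<suc[m/n]*n n t))) ⟩
  2 * (suc t * (suc k * n) + suc (n / suc t) * suc t) ≡⟨ factor (suc t) (suc k * n) (n / suc t) ⟩
  suc t * (2 * suc (suc k * n + n / suc t))          ≤⟨ *-monoʳ-≤ (suc t) (*-monoʳ-≤ 2 lt) ⟩
  suc t * (2 * m)                                    ∎
  where
  open ≤-Reasoning
  expand : ∀ k t n → 2 * (k * t + 1) * n ≡ 2 * (t * (k * n) + n)
  expand = solve-∀
  factor : ∀ t x q → 2 * (t * x + suc q * t) ≡ t * (2 * suc (x + q))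
  factor = solve-∀

-- The value of `popularBound` for a clique of size `M`, available before the colouring and its
-- clique are given, as the threshold for `n` requires.
fanBound : ℕ → ℕ → ℕ
fanBound k M = 2 ^ M * (3 * (2 + k)) + M

upperThreshold : ℕ → ℕ → ℕ → ℕ
upperThreshold k t M = 4 ^ (3 * M) + suc (pathThreshold k t (fanBound k M + fanBound k M))

admissible : ∀ k t M → 23 * (2 + k) ≤ M → ∀ n → upperThreshold k t M ≤ n → Admissible n (suc k) (suc k * n + n / suc t)
admissible k t M M≥ n n≥ c c-sym counts = around (Ramsey.ramsey c M (allFin n) (UniqueP.allFin⁺ n)
    (≤-trans (m≤m+n (4 ^ (3 * M)) _) (≤-trans n≥ (≤-reflexive (sym (length-tabulate id))))))
  where
  β = fanBound k M
  large : pathThreshold k t (β + β) < length (allFin n)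
  large = ≤-trans (m≤n+m _ (4 ^ (3 * M))) (≤-trans n≥ (≤-reflexive (sym (length-tabulate id))))
  around : Σ (Fin 3) (λ d → Σ (List (Fin n)) λ K → length K ≡ M × Ramsey.Clique c d K) → HasBalancedP3k n (suc k) c
  around (d , K , K-length , clique) with (a , b) , sp ← complement d =
    AroundClique.from-clique c c-sym k t clique {a} {b} β sp (subst (23 * (2 + k) ≤_) (sym K-length) M≥)
      (≤-reflexive (cong (fanBound k) K-length)) large (dense a) (dense b)
    where
    dense : ∀ e → AroundClique.Dense c c-sym k t clique e
    dense e = ≤-trans (subst (λ l → 2 * (suc k * suc t + 1) * l ≤ suc t * (2 * colourCount n c e)) (sym (length-tabulate id))
        (count⇒dense k t n (colourCount n c e) (counts e)))
      (*-monoʳ-≤ (suc t) (handshake c c-sym e))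

-- The lower bound

hubChoice : {P Q : Set} → Dec P → Dec Q → Fin 3
hubChoice (yes _) (yes _) = zero
hubChoice (yes _) (no _)  = suc zero
hubChoice (no _)  _       = suc (suc zero)

-- The colour of the edge between lo < hi: the j smallest vertices are the hubs, and an edge at
-- a hub is coloured 0 or 1 according to whether its other end is below p.
hubColour : ℕ → ℕ → ℕ → ℕ → Fin 3
hubColour j p lo hi = hubChoice (lo <? j) (hi <? p)

hubColouring : (j p n : ℕ) → Colouring n
hubColouring j p n x y = hubColour j p (toℕ x ⊓ toℕ y) (toℕ x ⊔ toℕ y)

hubColouring-sym : ∀ j p n → SymmetricColouring n (hubColouring j p n)
hubColouring-sym j p n x y = cong₂ (hubColour j p) (⊓-comm (toℕ x) (toℕ y)) (⊔-comm (toℕ x) (toℕ y))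

hub-edge : {P Q : Set} (d : Dec P) (e : Dec Q) →
  ind (hubChoice d e Fin.≟ zero) + ind (hubChoice d e Fin.≟ suc zero) ≤ ind d
hub-edge (yes _) (yes _) = ≤-refl
hub-edge (yes _) (no _)  = ≤-refl
hub-edge (no _)  _       = ≤-refl

⊓-hub : ∀ j x y → ind (x ⊓ y <? j) ≤ ind (x <? j) + ind (y <? j)
⊓-hub j x y with ⊓-sel x y
... | inj₁ eq rewrite eq = m≤m+n _ _
... | inj₂ eq rewrite eq = m≤n+m (ind (y <? j)) (ind (x <? j))

-- Every edge coloured 0 or 1 has one of the j hubs as an end, and a path passes through
-- each hub with at most two edges.
hubColouring-path : ∀ j p {n m} (v : Fin (suc m) → Fin n) → Injective _≡_ _≡_ v →
  pathColourCount n m (hubColouring j p n) v zero + pathColourCount n m (hubColouring j p n) v (suc zero) ≤ j + j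
hubColouring-path j p {n} {m} v inj = begin
  pathColourCount n m c v zero + pathColourCount n m c v (suc zero)
    ≡⟨ cong₂ _+_ (length-filter≡count (edge? zero) (allFin m)) (length-filter≡count (edge? (suc zero)) (allFin m)) ⟩
  count (edge? zero) (allFin m) + count (edge? (suc zero)) (allFin m) ≡⟨ ∑-+ (λ i → ind (edge? zero i)) (λ i → ind (edge? (suc zero) i)) (allFin m) ⟨
  ∑ (λ i → ind (edge? zero i) + ind (edge? (suc zero) i)) (allFin m)
    ≤⟨ ∑-mono (allFin m) (λ {i} _ → ≤-trans (hub-edge (toℕ (v (inject₁ i)) ⊓ toℕ (v (suc i)) <? j) (toℕ (v (inject₁ i)) ⊔ toℕ (v (suc i)) <? p))
                                             (⊓-hub j (toℕ (v (inject₁ i))) (toℕ (v (suc i))))) ⟩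
  ∑ (λ i → hub (inject₁ i) + hub (suc i)) (allFin m) ≡⟨ ∑-+ (hub ∘ inject₁) (hub ∘ suc) (allFin m) ⟩
  ∑ (hub ∘ inject₁) (allFin m) + ∑ (hub ∘ suc) (allFin m)
    ≤⟨ +-mono-≤ (embed inject₁ inject₁-injective) (embed suc FinP.suc-injective) ⟩
  j + j ∎
  where
  open ≤-Reasoning
  c = hubColouring j p n
  edge? : ∀ col (i : Fin m) → Dec (c (v (inject₁ i)) (v (suc i)) ≡ col)
  edge? col i = c (v (inject₁ i)) (v (suc i)) Fin.≟ col
  hub : Fin (suc m) → ℕ
  hub i = ind (toℕ (v i) <? j)
  embed : (f : Fin m → Fin (suc m)) → (∀ {x y} → f x ≡ f y → x ≡ y) → ∑ (hub ∘ f) (allFin m) ≤ j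
  embed f f-inj = begin
    ∑ (hub ∘ f) (allFin m)                               ≡⟨ ∑-map (λ x → ind (x <? j)) (toℕ ∘ v ∘ f) (allFin m) ⟨
    ∑ (λ x → ind (x <? j)) (map (toℕ ∘ v ∘ f) (allFin m))
      ≤⟨ Unique⇒∑≤ (upTo j) (UniqueP.map⁺ (f-inj ∘ inj ∘ toℕ-injective) (UniqueP.allFin⁺ m)) (λ {x} _ → small x) ⟩
    ∑ (λ x → ind (x <? j)) (upTo j)                      ≤⟨ ∑-bound 1 (upTo j) (λ {x} _ → ind≤1 (x <? j)) ⟩
    length (upTo j) * 1                                  ≡⟨ trans (*-identityʳ _) (length-upTo j) ⟩
    j                                                    ∎
    where
    small : ∀ x → ind (x <? j) ≢ 0 → x ∈ upTo j
    small x nz with x <? j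
    ... | yes x<j = ∈-upTo⁺ x<j
    ... | no x≮j  = contradiction (ind-no (x <? j) x≮j) nz

no-balanced : ∀ j p n → ¬ HasBalancedP3k n (suc j) (hubColouring j p n)
no-balanced j p n (v , inj , counts) = <⇒≱ (+-mono-< (n<1+n j) (n<1+n j))
  (subst₂ (λ a b → a + b ≤ j + j) (counts zero) (counts (suc zero)) (hubColouring-path j p v inj))

interval? : ∀ α β (x : ℕ) → Dec (α ≤ x × x < β)
interval? α β x = (α ≤? x) ×-dec (x <? β)

interval-count : ∀ {n} α β → β ≤ n → β ∸ α ≤ count (λ x → interval? α β (toℕ x)) (allFin n)
interval-count {n} α β β≤n = begin
  β ∸ α                                    ≡⟨ trans (length-map (α +_) (upTo (β ∸ α))) (length-upTo (β ∸ α)) ⟨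
  length ys                                ≡⟨ *-identityʳ (length ys) ⟨
  length ys * 1                            ≤⟨ ∑-lower 1 ys (λ {x} x∈ → ≤-reflexive (sym (ind-yes (interval? α β x) (ys-∈ x∈)))) ⟩
  count (interval? α β) ys                 ≤⟨ Unique⇒∑≤ (map toℕ (allFin n)) (UniqueP.map⁺ (λ {x} {y} → +-cancelˡ-≡ α x y) (UniqueP.upTo⁺ (β ∸ α)))
                                                (λ {x} x∈ _ → subst (_∈ map toℕ (allFin n)) (toℕ-fromℕ< (<-≤-trans (proj₂ (ys-∈ x∈)) β≤n))
                                                  (∈-map⁺ toℕ (∈-allFin (fromℕ< (<-≤-trans (proj₂ (ys-∈ x∈)) β≤n))))) ⟩
  count (interval? α β) (map toℕ (allFin n)) ≡⟨ ∑-map (λ x → ind (interval? α β x)) toℕ (allFin n) ⟩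
  count (λ x → interval? α β (toℕ x)) (allFin n) ∎
  where
  open ≤-Reasoning
  ys = map (α +_) (upTo (β ∸ α))
  ys-∈ : ∀ {x} → x ∈ ys → α ≤ x × x < β
  ys-∈ x∈ with i , i∈ , refl ← ∈-map⁻ (α +_) x∈ = m≤m+n α i , subst (_≤ β) (cong suc (+-comm i α))
    (m≤o∸n⇒m+n≤o (suc i) (<⇒≤ (m∸n≢0⇒n<m λ eq → case subst (i <_) eq (∈-upTo⁻ i∈) of λ ())) (∈-upTo⁻ i∈))

rectangle : ∀ {n} (c : Colouring n) col α β γ δ → β ≤ n → δ ≤ n →
  (∀ x y → α ≤ toℕ x × toℕ x < β → γ ≤ toℕ y × toℕ y < δ → toℕ x < toℕ y × c x y ≡ col) →
  (β ∸ α) * (δ ∸ γ) ≤ colourCount n c col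
rectangle {n} c col α β γ δ β≤n δ≤n h = begin
  (β ∸ α) * (δ ∸ γ)   ≤⟨ *-monoˡ-≤ (δ ∸ γ) (≤-trans (interval-count α β β≤n) (≤-reflexive (sym (length-filter≡count row? U)))) ⟩
  length (filter row? U) * (δ ∸ γ)
    ≤⟨ ∑-lower (δ ∸ γ) (filter row? U) (λ {x} x∈ → ≤-trans (interval-count γ δ δ≤n)
         (∑-mono U λ {y} _ → ind-mono (interval? γ δ (toℕ y)) (ordered? c col x y) (h x y (proj₂ (∈-filter⁻ row? {xs = U} x∈))))) ⟩
  ∑ (λ x → count (ordered? c col x) U) (filter row? U) ≤⟨ ∑-filter≤ row? _ U ⟩
  ∑ (λ x → count (ordered? c col x) U) U               ≡⟨ colourCount≡∑ c col ⟨
  colourCount n c col ∎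
  where
  open ≤-Reasoning
  U = allFin n
  row? : Decidable (λ (x : Fin n) → α ≤ toℕ x × toℕ x < β)
  row? x = interval? α β (toℕ x)

hubChoice-0 : {P Q : Set} (d : Dec P) (e : Dec Q) → P → Q → hubChoice d e ≡ zero
hubChoice-0 (yes _) (yes _) _ _ = refl
hubChoice-0 (yes _) (no ¬q) _ q = contradiction q ¬q
hubChoice-0 (no ¬p) _       p _ = contradiction p ¬p

hubChoice-1 : {P Q : Set} (d : Dec P) (e : Dec Q) → P → ¬ Q → hubChoice d e ≡ suc zero
hubChoice-1 (yes _) (yes q) _ ¬q = contradiction q ¬q
hubChoice-1 (yes _) (no _)  _ _  = refl
hubChoice-1 (no ¬p) _       p _  = contradiction p ¬p

hubChoice-2 : {P Q : Set} (d : Dec P) (e : Dec Q) → ¬ P → hubChoice d e ≡ suc (suc zero)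
hubChoice-2 (yes p) _ ¬p = contradiction p ¬p
hubChoice-2 (no _)  _ _  = refl

hubColouring-< : ∀ {j p n col} (x y : Fin n) → toℕ x < toℕ y → hubColour j p (toℕ x) (toℕ y) ≡ col →
  toℕ x < toℕ y × hubColouring j p n x y ≡ col
hubColouring-< {j} {p} x y x<y eq = x<y ,
  trans (cong₂ (hubColour j p) (m≤n⇒m⊓n≡m (<⇒≤ x<y)) (m≤n⇒m⊔n≡n (<⇒≤ x<y))) eq

-- One rectangle of pairs for each colour: hubs with [j, p), hubs with [p, n), and [j, p) with [p,
-- n). As `n` is at least `2p` and `p` at least `2j`, the first rectangle is the smallest and gives
-- the common bound.
hubColouring-counts : ∀ j p n → j + j ≤ p → p + p ≤ n → ∀ col → j * (p ∸ j) ≤ colourCount n (hubColouring j p n) col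
hubColouring-counts j p n 2j≤p 2p≤n = λ
  { zero → rectangle c zero 0 j j p (≤-trans j≤p p≤n) p≤n
      (λ x y (_ , x<j) (j≤y , y<p) → hubColouring-< {j} {p} x y (<-≤-trans x<j j≤y) (hubChoice-0 (toℕ x <? j) (toℕ y <? p) x<j y<p))
  ; (suc zero) → ≤-trans (*-monoʳ-≤ j (≤-trans (m∸n≤m p j) p≤n∸p))
      (rectangle c (suc zero) 0 j p n (≤-trans j≤p p≤n) ≤-refl
        (λ x y (_ , x<j) (p≤y , _) → hubColouring-< {j} {p} x y (<-≤-trans x<j (≤-trans j≤p p≤y)) (hubChoice-1 (toℕ x <? j) (toℕ y <? p) x<j (≤⇒≯ p≤y))))
  ; (suc (suc zero)) → ≤-trans (≤-trans (≤-reflexive (*-comm j (p ∸ j))) (*-monoʳ-≤ (p ∸ j) (≤-trans j≤p p≤n∸p)))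
      (rectangle c (suc (suc zero)) j p p n p≤n ≤-refl
        (λ x y (j≤x , x<p) (p≤y , _) → hubColouring-< {j} {p} x y (<-≤-trans x<p p≤y) (hubChoice-2 (toℕ x <? j) (toℕ y <? p) (≤⇒≯ j≤x))))
  }
  where
  c = hubColouring j p n
  j≤p : j ≤ p
  j≤p = ≤-trans (m≤m+n j j) 2j≤p
  p≤n : p ≤ n
  p≤n = ≤-trans (m≤m+n p p) 2p≤n
  p≤n∸p : p ≤ n ∸ p
  p≤n∸p = m+n≤o⇒m≤o∸n p 2p≤n

-- The first summand absorbs the pairs lost to the hubs themselves and to rounding n / 2; the second
-- makes `j + j` at most `⌊ n /2⌋`.
lowerThreshold : ℕ → ℕ → ℕ
lowerThreshold j t = j * suc t * (2 * j + 1) + (j + j + (j + j))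

-- The inequality on `m` says that m / n is below j / 2 - 1 / (t + 1). Since each colour occurs on
-- at least j(n / 2 - j) edges up to rounding, the term 1 / (t + 1) pays for the rest once `n` is
-- large.
inadmissible : ∀ j t n → lowerThreshold j t ≤ n → ∀ m → 2 * m * suc t + 2 * n < j * suc t * n → ¬ Admissible n (suc j) m
inadmissible j t n n≥ m lt adm = no-balanced j p n
  (adm (hubColouring j p n) (hubColouring-sym j p n) λ col → <-≤-trans m< (hubColouring-counts j p n 2j≤p 2p≤n col))
  where
  open ≤-Reasoning
  p = ⌊ n /2⌋
  2j≤p : j + j ≤ p
  2j≤p = ≤-trans (≤-reflexive (n≡⌊n+n/2⌋ (j + j))) (⌊n/2⌋-mono (≤-trans (m≤n+m _ (j * suc t * (2 * j + 1))) n≥))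
  2p≤n : p + p ≤ n
  2p≤n = halves≤ n
  n≤ : n ≤ 2 * ((p ∸ j) + j) + 1
  n≤ = begin
    n                       ≤⟨ s≤s⁻¹ (≤-trans (≤halves n) (≤-reflexive (double p))) ⟩
    2 * p + 1               ≡⟨ cong (λ q → 2 * q + 1) (m∸n+n≡m (≤-trans (m≤m+n j j) 2j≤p)) ⟨
    2 * ((p ∸ j) + j) + 1   ∎
    where
    double : ∀ p → suc p + suc p ≡ suc (2 * p + 1)
    double = solve-∀
  m< : m < j * (p ∸ j)
  m< = ≰⇒> λ le → <⇒≱ lt (begin
    j * suc t * n                                     ≤⟨ *-monoʳ-≤ (j * suc t) n≤ ⟩
    j * suc t * (2 * ((p ∸ j) + j) + 1)               ≡⟨ expand j (suc t) (p ∸ j) ⟩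
    2 * (j * (p ∸ j)) * suc t + j * suc t * (2 * j + 1) ≤⟨ +-mono-≤ (*-monoˡ-≤ (suc t) (*-monoʳ-≤ 2 le)) (≤-trans (≤-trans (m≤m+n _ _) n≥) (m≤m+n n _)) ⟩
    2 * m * suc t + 2 * n                             ∎)
    where
    expand : ∀ j t q → j * t * (2 * (q + j) + 1) ≡ 2 * (j * q) * t + j * t * (2 * j + 1)
    expand = solve-∀

-- Both bounds for all large `n`

bounds : ∀ k t M → 23 * (2 + k) ≤ M → Σ ℕ λ N → (n : ℕ) → N ≤ n →
  (Σ ℕ λ m → (m * suc t ≤ suc k * n * suc t + n) × Admissible n (suc k) m)
  × ((m : ℕ) → 2 * m * suc t + 2 * n < k * suc t * n → ¬ Admissible n (suc k) m)
bounds k t M M≥ = upperThreshold k t M + lowerThreshold k t , λ n N≤n →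
  ( suc k * n + n / suc t
  , ≤-trans (≤-reflexive (*-distribʳ-+ (suc t) (suc k * n) (n / suc t))) (+-monoʳ-≤ (suc k * n * suc t) (m/n*n≤m n (suc t)))
  , admissible k t M M≥ n (≤-trans (m≤m+n (upperThreshold k t M) _) N≤n) )
  , inadmissible k t n (≤-trans (m≤n+m (lowerThreshold k t) (upperThreshold k t M)) N≤n)

theorem1p10 : (k : ℕ) → 1 ≤ k → (t : ℕ) → Σ ℕ λ N → (n : ℕ) → N ≤ n →
    (Σ ℕ λ m → (m * suc t ≤ k * n * suc t + n) × Admissible n k m)
    × ((m : ℕ) → 2 * m * suc t + 2 * n < (k ∸ 1) * suc t * n → ¬ Admissible n k m)
theorem1p10 (suc k) _ t = bounds k t (23 * (2 + k)) ≤-refl
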